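{- Consider the following algorithm on a graph $G$ on $[n]$: for each pair of crossing edges $e,f$, find a shortest path $P(e,f)=x_0x_1\dots x_k$ in $G$ with $e=x_0x_1$ and $f=x_{k-1}x_k$ (necessarily $k\ge 3$). If for some crossing pair $e,f$ no such path exists, or $k\ge 4$ and some vertex $x_i$ with $2\le i\le k-2$ does not separate $e$ and $f$, output "No"; otherwise output "Yes". This algorithm outputs "Yes" if and only if $G$ is crossing closed (equivalently, $NC_G$ is a lattice), and it runs in time $O(n^7)$.
   Context: Graphs are finite simple graphs with vertex set $[n]$; edges are written $ij$ with $i<j$. Two edges $a_1a_2$ and $b_1b_2$ cross if $a_1<b_1<a_2<b_2$ or $b_1<a_1<b_2<a_2$. A vertex $x$ separates edges $e$ and $f$ if $e$ and $f$ lie in different connected components of $G\setminus x$. Two crossing edges $e,f$ are crossing closed if among all induced connected subgraphs of $G$ containing $e$ and $f$ there is a unique minimal one under containment; $G$ is crossing closed if every pair of crossing edges is. $NC_G$ is the poset of noncrossing bonds of $G$ (spanning subgraphs whose components are induced subgraphs of $G$ and whose component vertex sets form a noncrossing partition of $[n]$), ordered by inclusion of edge sets. -}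

module Defs where

open import Data.Bool.Base using (Bool; true; false; not; _∧_; if_then_else_)
open import Data.Bool.Properties using (⇔→≡)
open import Data.Fin.Base using (Fin; zero; suc; toℕ; fromℕ; fromℕ<; inject₁; _<_)
open import Data.Fin.Subset using (Subset; _∈_; _⊆_; Nonempty; ∁; ⁅_⁆)
open import Data.Nat.Base as ℕ using (ℕ; zero; suc; _+_; _∸_; _≡ᵇ_; _<ᵇ_)
open import Data.Nat.Properties using (_<?_)
open import Data.Product using (Σ; ∃; ∃₂; ∃!; _×_; _,_)
open import Data.Sum.Base using (_⊎_; inj₁; inj₂)
open import Data.Unit.Base using (⊤)
open import Function.Bundles using (mk⇔)
open import Function.Definitions using (Injective)
open import Level using (0ℓ)
open import Relation.Binary.Bundles using (Poset)
open import Relation.Binary.Core using (Rel)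
open import Relation.Binary.Construct.Closure.ReflexiveTransitive using (Star)
open import Relation.Binary.Lattice.Structures using (IsLattice)
open import Relation.Binary.PropositionalEquality using (_≡_; refl; sym; trans)
open import Relation.Nullary using (¬_; yes; no)

------------------------------------------------------------------------
-- Graphs

record Graph (n : ℕ) : Set where
  field
    adj    : Fin n → Fin n → Bool
    symm   : ∀ u v → adj u v ≡ adj v u
    irrefl : ∀ u → adj u u ≡ false

  Adj : Rel (Fin n) 0ℓ
  Adj u v = adj u v ≡ true

open Graph public using (adj; Adj)

-- Two vertices are related iff they lie in the same connected component.
SameComponent : ∀ {n} → Graph n → Rel (Fin n) 0ℓ
SameComponent G = Star (Adj G)

record Edge {n : ℕ} (G : Graph n) : Set where
  field
    lo hi    : Fin n
    lo<hi    : lo < hi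
    adjacent : Adj G lo hi

open Edge public using (lo; hi)

module _ {n : ℕ} {G : Graph n} where

  Crosses : Rel (Edge G) 0ℓ
  Crosses e f = (lo e < lo f × lo f < hi e × hi e < hi f)
              ⊎ (lo f < lo e × lo e < hi f × hi f < hi e)

  -- e = uv as an unordered pair
  Joins : Edge G → Fin n → Fin n → Set
  Joins e u v = (lo e ≡ u × hi e ≡ v) ⊎ (lo e ≡ v × hi e ≡ u)

  _⊑_ : Edge G → Subset n → Set
  e ⊑ U = lo e ∈ U × hi e ∈ U

-- Induced subgraphs are represented by their vertex sets: G[U] ⊆ G[V] iff U ⊆ V,
-- and G[U] contains the edge e of G iff e ⊑ U.

module _ {n : ℕ} (G : Graph n) where

  -- adjacency in G[U]
  AdjIn : Subset n → Rel (Fin n) 0ℓ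
  AdjIn U u v = u ∈ U × v ∈ U × Adj G u v

  ConnectedOn : Subset n → Set
  ConnectedOn U = Nonempty U × (∀ {u v} → u ∈ U → v ∈ U → Star (AdjIn U) u v)

  -- e and f are edges of G ∖ x = G[∁ ⁅ x ⁆] in different components of it; the
  -- component of an edge is that of either endpoint.
  Separates : Fin n → Edge G → Edge G → Set
  Separates x e f = e ⊑ ∁ ⁅ x ⁆ × f ⊑ ∁ ⁅ x ⁆ × ¬ Star (AdjIn (∁ ⁅ x ⁆)) (lo e) (lo f)

  ConnectedContaining : Edge G → Edge G → Subset n → Set
  ConnectedContaining e f U = ConnectedOn U × e ⊑ U × f ⊑ U

  Minimal : (Subset n → Set) → Subset n → Set
  Minimal P U = P U × (∀ {V} → P V → V ⊆ U → V ≡ U)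

  CrossingClosed : Set
  CrossingClosed = ∀ (e f : Edge G) → Crosses e f →
                   ∃! _≡_ (Minimal (ConnectedContaining e f))

------------------------------------------------------------------------
-- The noncrossing bond poset

  record NCBond : Set where
    field
      graph       : Graph n
      subgraph    : ∀ {u v} → Adj graph u v → Adj G u v
      induced     : ∀ {u v} → SameComponent graph u v → Adj G u v → Adj graph u v
      noncrossing : ∀ {a b c d} → a < b → b < c → c < d →
                    SameComponent graph a c → SameComponent graph b d →
                    SameComponent graph a b

  open NCBond

  NC : Poset 0ℓ 0ℓ 0ℓ
  NC = record
    { Carrier        = NCBond
    ; _≈_            = λ H K → ∀ u v → adj (graph H) u v ≡ adj (graph K) u v
    ; _≤_            = λ H K → ∀ u v → Adj (graph H) u v → Adj (graph K) u v
    ; isPartialOrder = record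
      { isPreorder = record
        { isEquivalence = record
          { refl  = λ _ _ → refl
          ; sym   = λ p u v → sym (p u v)
          ; trans = λ p q u v → trans (p u v) (q u v)
          }
        ; reflexive = λ p u v h → trans (sym (p u v)) h
        ; trans     = λ p q u v h → q u v (p u v h)
        }
      ; antisym = λ p q u v → ⇔→≡ (mk⇔ (p u v) (q u v))
      }
    }

IsLatticePoset : ∀ {a ℓ₁ ℓ₂} → Poset a ℓ₁ ℓ₂ → Set _
IsLatticePoset P = ∃₂ λ _∨_ _∧_ → IsLattice _≈_ _≤_ _∨_ _∧_
  where open Poset P

------------------------------------------------------------------------
-- The algorithm, for an arbitrary choice of the shortest paths P(e,f)

-- x₀ x₁ … x_k with k = suc m; the first step is e and the last one is f.
record PathBetween {n : ℕ} {G : Graph n} (e f : Edge G) : Set where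
  field
    m         : ℕ
    vertex    : Fin (suc (suc m)) → Fin n
    injective : Injective _≡_ _≡_ vertex
    step      : ∀ (i : Fin (suc m)) → Adj G (vertex (inject₁ i)) (vertex (suc i))
    first     : Joins e (vertex (inject₁ zero)) (vertex (suc zero))
    last      : Joins f (vertex (inject₁ (fromℕ m))) (vertex (suc (fromℕ m)))

  length : ℕ
  length = suc m

open PathBetween public using (vertex; length)

data Answer : Set where
  Yes No : Answer

module _ {n : ℕ} (G : Graph n) where

  ShortestPath : Edge G → Edge G → Set
  ShortestPath e f = Σ (PathBetween e f) λ P → (Q : PathBetween e f) → length P ℕ.≤ length Q

  -- The outcomes of all the path searches.
  Run : Set
  Run = (e f : Edge G) → Crosses e f → ShortestPath e f ⊎ ¬ PathBetween e f

  Fails : ∀ {e f} → ShortestPath e f ⊎ ¬ PathBetween e f → Set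
  Fails {e} {f} (inj₁ (P , _)) =
    4 ℕ.≤ length P ×
    ∃ λ i → 2 ℕ.≤ toℕ i × toℕ i ℕ.≤ length P ∸ 2 × ¬ Separates G (vertex P i) e f
  Fails (inj₂ _) = ⊤

  Outputs : Run → Answer → Set
  Outputs r No  = ∃₂ λ (e f : Edge G) → Σ (Crosses e f) λ c → Fails (r e f c)
  Outputs r Yes = ¬ Outputs r No

------------------------------------------------------------------------
-- A unit-cost random access machine

-- The input graph is given by its order and its adjacency matrix; a program can
-- only compare numbers, take successors, and access registers, arrays and matrix
-- entries, so unit cost is justified: the largest value grows by at most one per step.

Register Array : Set
Register = ℕ
Array    = ℕ

data Expr : Set where
  lit  : ℕ → Expr
  size : Expr
  reg  : Register → Expr
  _⟦_⟧ : Array → Expr → Expr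
  inc  : Expr → Expr

data Test : Set where
  _==_ _<<_ adjacent? : Expr → Expr → Test
  _&&_                : Test → Test → Test
  neg                 : Test → Test

data Stmt : Set where
  skip            : Stmt
  _≔_             : Register → Expr → Stmt
  _⟦_⟧≔_          : Array → Expr → Expr → Stmt
  _⍮_             : Stmt → Stmt → Stmt
  If_Then_Else_   : Test → Stmt → Stmt → Stmt
  For_Below_Do_   : Register → Expr → Stmt → Stmt

infix  8 _⟦_⟧
infix  7 _==_ _<<_
infixr 6 _&&_
infix  5 _≔_ _⟦_⟧≔_
infix  4 If_Then_Else_ For_Below_Do_
infixr 3 _⍮_

record State : Set where
  constructor state
  field
    regs   : Register → ℕ
    arrays : Array → ℕ → ℕ

open State public

setReg : Register → ℕ → State → State
setReg r x σ = record σ { regs = λ s → if s ≡ᵇ r then x else regs σ s }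

setCell : Array → ℕ → ℕ → State → State
setCell A i x σ = record σ
  { arrays = λ B j → if (B ≡ᵇ A) ∧ (j ≡ᵇ i) then x else arrays σ B j }

initial : State
initial = state (λ _ → 0) (λ _ _ → 0)

iterate : (ℕ → State → State) → ℕ → State → State
iterate f zero    σ = σ
iterate f (suc k) σ = f k (iterate f k σ)

sumBelow : (ℕ → ℕ) → ℕ → ℕ
sumBelow f zero    = 0
sumBelow f (suc k) = sumBelow f k + f k

module Machine {n : ℕ} (G : Graph n) where

  entry : ℕ → ℕ → Bool
  entry i j with i <? n | j <? n
  ... | yes i<n | yes j<n = adj G (fromℕ< i<n) (fromℕ< j<n)
  ... | _       | _       = false

  ⟦_⟧ᵉ : Expr → State → ℕ
  ⟦ lit k ⟧ᵉ   σ = k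
  ⟦ size ⟧ᵉ    σ = n
  ⟦ reg r ⟧ᵉ   σ = regs σ r
  ⟦ A ⟦ E ⟧ ⟧ᵉ σ = arrays σ A (⟦ E ⟧ᵉ σ)
  ⟦ inc E ⟧ᵉ   σ = suc (⟦ E ⟧ᵉ σ)

  ⟦_⟧ᵗ : Test → State → Bool
  ⟦ E == F ⟧ᵗ        σ = ⟦ E ⟧ᵉ σ ≡ᵇ ⟦ F ⟧ᵉ σ
  ⟦ E << F ⟧ᵗ        σ = ⟦ E ⟧ᵉ σ <ᵇ ⟦ F ⟧ᵉ σ
  ⟦ adjacent? E F ⟧ᵗ σ = entry (⟦ E ⟧ᵉ σ) (⟦ F ⟧ᵉ σ)
  ⟦ S && T ⟧ᵗ        σ = ⟦ S ⟧ᵗ σ ∧ ⟦ T ⟧ᵗ σ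
  ⟦ neg T ⟧ᵗ         σ = not (⟦ T ⟧ᵗ σ)

  -- The bound of a loop is evaluated once, on entry, and the counter is reset at the
  -- start of each round.
  run : Stmt → State → State
  run skip                  σ = σ
  run (r ≔ E)               σ = setReg r (⟦ E ⟧ᵉ σ) σ
  run (A ⟦ E ⟧≔ F)          σ = setCell A (⟦ E ⟧ᵉ σ) (⟦ F ⟧ᵉ σ) σ
  run (S ⍮ S′)              σ = run S′ (run S σ)
  run (If T Then S Else S′) σ = if ⟦ T ⟧ᵗ σ then run S σ else run S′ σ
  run (For r Below E Do S)  σ = iterate (λ j τ → run S (setReg r j τ)) (⟦ E ⟧ᵉ σ) σ

  -- Both operands of && are charged for.
  costᵉ : Expr → ℕ
  costᵉ (lit _)   = 1
  costᵉ size      = 1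
  costᵉ (reg _)   = 1
  costᵉ (A ⟦ E ⟧) = suc (costᵉ E)
  costᵉ (inc E)   = suc (costᵉ E)

  costᵗ : Test → ℕ
  costᵗ (E == F)        = suc (costᵉ E + costᵉ F)
  costᵗ (E << F)        = suc (costᵉ E + costᵉ F)
  costᵗ (adjacent? E F) = suc (costᵉ E + costᵉ F)
  costᵗ (S && T)        = suc (costᵗ S + costᵗ T)
  costᵗ (neg T)         = suc (costᵗ T)

  time : Stmt → State → ℕ
  time skip                  σ = 1
  time (r ≔ E)               σ = suc (costᵉ E)
  time (A ⟦ E ⟧≔ F)          σ = suc (costᵉ E + costᵉ F)
  time (S ⍮ S′)              σ = time S σ + time S′ (run S σ)
  time (If T Then S Else S′) σ =
    suc (costᵗ T) + (if ⟦ T ⟧ᵗ σ then time S σ else time S′ σ)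
  time (For r Below E Do S)  σ =
    suc (costᵉ E) +
    sumBelow (λ j → suc (time S (setReg r j (iterate (λ k τ → run S (setReg r k τ)) j σ))))
             (⟦ E ⟧ᵉ σ)

------------------------------------------------------------------------
-- The algorithm as a program

module Program where

  a₁ a₂ b₁ b₂ removed target y i head tail u v answer : Register
  a₁      = 0
  a₂      = 1
  b₁      = 2
  b₂      = 3
  removed = 4
  target  = 5
  y       = 6
  i       = 7
  head    = 8
  tail    = 9
  u       = 10
  v       = 11
  answer  = 12

  queue level parent level′ parent′ : Array
  queue   = 0
  level   = 1
  parent  = 2
  level′  = 3
  parent′ = 4

  enqueue : Register → Stmt
  enqueue r = queue ⟦ reg tail ⟧≔ reg r ⍮ tail ≔ inc (reg tail)

  -- Breadth-first search in G ∖ removed, from both ends of the edge a₁a₂.  Afterwards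
  -- lev holds 1 + the distance from {a₁, a₂}, or 0 at unreachable vertices, and par
  -- holds the predecessor of every reached vertex other than a₁ and a₂.
  search : (lev par : Array) → Stmt
  search lev par =
    (For v Below size Do lev ⟦ reg v ⟧≔ lit 0) ⍮
    tail ≔ lit 0 ⍮
    lev ⟦ reg a₁ ⟧≔ lit 1 ⍮ enqueue a₁ ⍮
    lev ⟦ reg a₂ ⟧≔ lit 1 ⍮ enqueue a₂ ⍮
    (For head Below size Do
      If reg head << reg tail Then
        (u ≔ queue ⟦ reg head ⟧ ⍮
        (For v Below size Do
          If adjacent? (reg u) (reg v) && neg (reg v == reg removed)
               && lev ⟦ reg v ⟧ == lit 0
          Then (lev ⟦ reg v ⟧≔ inc (lev ⟦ reg u ⟧) ⍮
                par ⟦ reg v ⟧≔ reg u ⍮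
                enqueue v)
          Else skip))
      Else skip)

  -- y runs through x_{k-2}, …, x₂, where target = x_{k-1}; it stops at x₁ ∈ {a₁, a₂}.
  checkPath : Stmt
  checkPath =
    y ≔ parent ⟦ reg target ⟧ ⍮
    (For i Below size Do
      If neg (reg y == reg a₁) && neg (reg y == reg a₂) Then
        (removed ≔ reg y ⍮
        search level′ parent′ ⍮
        (If level′ ⟦ reg b₁ ⟧ == lit 0 Then skip Else answer ≔ lit 0) ⍮
        y ≔ parent ⟦ reg y ⟧)
      Else skip)

  -- The value `size` of removed is not a vertex, so the first search is in all of G.
  checkPair : Stmt
  checkPair =
    removed ≔ size ⍮
    search level parent ⍮
    (If level ⟦ reg b₁ ⟧ == lit 0
     Then answer ≔ lit 0
     Else ((If level ⟦ reg b₂ ⟧ << level ⟦ reg b₁ ⟧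
            Then target ≔ reg b₂
            Else target ≔ reg b₁) ⍮
           checkPath))

  -- Every unordered pair of crossing edges is met once, as a₁ < b₁ < a₂ < b₂.
  program : Stmt
  program =
    answer ≔ lit 1 ⍮
    (For a₁ Below size Do For b₁ Below size Do For a₂ Below size Do For b₂ Below size Do
      If reg a₁ << reg b₁ && reg b₁ << reg a₂ && reg a₂ << reg b₂
           && adjacent? (reg a₁) (reg a₂) && adjacent? (reg b₁) (reg b₂)
      Then checkPair
      Else skip)

programAnswer : ∀ {n} → Graph n → Answer
programAnswer G =
  if regs (Machine.run G Program.program initial) Program.answer ≡ᵇ 0 then No else Yes

programTime : ∀ {n} → Graph n → ℕ
programTime G = Machine.time G Program.program initial

{-# OPTIONS --safe #-}

-- The connected sets containing crossing edges e and f have a unique minimal element iff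
-- they have a least one, M.  A vertex that separates e and f lies in all of these sets, so
-- a path all of whose inner vertices separate is M.  Conversely, an inner vertex x of a
-- shortest path that does not separate lies outside M, and M then contains a shortcut.
--
-- If G is crossing closed, intersecting a family of noncrossing bonds edgewise gives a
-- noncrossing bond, so joins are intersections of upper bounds.  Conversely, M is the
-- vertex set of the component containing e in the join of the two bonds whose only edges
-- are e and f.
--
-- The breadth-first search computes exact distances from e, so that the path that the
-- program follows is a shortest one and each vertex that it rejects refutes closedness.
-- The running time is bounded syntactically: every loop makes n rounds.

module Submission where

open import Defs
open import Data.Bool.Base using (Bool; true; false; not; _∧_; _∨_; if_then_else_)
open import Data.Bool.Properties using (T-≡; ¬-not) renaming (_≟_ to _≟ᵇ_)
open import Data.Empty using (⊥; ⊥-elim)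
open import Data.Fin.Base as Fin using (Fin; zero; suc; toℕ; fromℕ; fromℕ<; inject₁; combine)
open import Data.Fin.Properties using
  (any?; all?; _≟_; _<?_; <-cmp; <-trans; toℕ<n; toℕ-injective; toℕ-inject₁; toℕ-fromℕ;
      toℕ-fromℕ<; fromℕ<-toℕ;
   injective⇒≤; remQuot-combine)
open import Data.Fin.Relation.Unary.Top using (view; ‵fromℕ; ‵inject₁)
open import Data.Fin.Subset using (Subset; _∈_; _∉_; _⊆_; _⊂_; _⊃_; _∪_; ⁅_⁆; ∁)
open import Data.Fin.Subset.Induction using (⊂-wellFounded; ⊃-wellFounded)
open import Data.Fin.Subset.Properties using
  (_∈?_; nonempty?; anySubset?; ⊆-antisym; x∈⁅x⁆; x∈⁅y⁆⇒x≡y; x∈p∪q⁺; x∈p∪q⁻; x∈p⇒x∉∁p; x∈∁p⇒x∉p; x∉p⇒x∈∁p)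
open import Data.Nat.Base as ℕ using
  (ℕ; zero; suc; _+_; _*_; _∸_; _^_; _⊔_; _≤_; _<_; _≡ᵇ_; _<ᵇ_; z≤n; s≤s; NonZero)
import Data.Nat.Properties as ℕₚ
open import Data.Product using (Σ; ∃; ∃₂; _×_; _,_; proj₁; proj₂; uncurry)
open import Data.Sum.Base using (_⊎_; inj₁; inj₂; [_,_]′)
open import Data.Unit.Base using (⊤; tt)
open import Data.Vec.Base using (lookup; tabulate)
open import Data.Vec.Properties using ([]=⇒lookup; lookup⇒[]=; lookup∘tabulate)
open import Function.Base using (_∘_; id)
open import Function.Bundles using (_⇔_; mk⇔; Equivalence)
open import Induction.WellFounded using (Acc; acc)
open import Level using (0ℓ)
open import Relation.Binary.Bundles using (Poset)
open import Relation.Binary.Construct.Closure.ReflexiveTransitive as Star using (Star; ε; _◅_; _◅◅_)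
open import Relation.Binary.Core using (Rel)
open import Relation.Binary.Definitions using (Symmetric; tri<; tri≈; tri>) renaming (Decidable to Decidable₂)
open import Relation.Binary.Lattice.Structures using (IsLattice)
open import Relation.Binary.PropositionalEquality using
  (_≡_; _≢_; refl; sym; trans; cong; cong₂; subst; subst₂)
open import Relation.Nullary using (¬_; Dec; yes; no; does; contradiction)
open import Relation.Nullary.Decidable using
  (_×-dec_; _⊎-dec_; _→-dec_; ¬?; map′; dec-true; dec-false; does-⇔; decidable-stable)
open import Relation.Unary using (Pred; Decidable)

-- Everything passes through `∃ (Least e f)`: a pair fails in a run exactly when there is no least
-- set, whichever shortest path was chosen, and the program's verdict on the pair is the same. Thus
-- the paths that the program follows never have to be matched with those of a run.
--
-- A path x₀ ... x_k with end edges e and f is handled as its inner walk x₁ ... x_{k-1}, of length d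
-- = k - 2. Minimality of k becomes the bound `Far e f d`, which also applies to walks with repeated
-- vertices, so cutting and pasting need not preserve injectivity.
--
-- The argument is constructive: separation, connectedness and membership of an edge in every bond
-- of a family are decided by exhaustive search over finite sets.
--
-- The exponent 7 counts four loops that choose the pair, one along the path, and two in each
-- search.

-- Reachability

module _ {n : ℕ} where

  comprehension : {P : Pred (Fin n) 0ℓ} → Decidable P → Subset n
  comprehension P? = tabulate (does ∘ P?)

  ∈-comprehension⁺ : {P : Pred (Fin n) 0ℓ} (P? : Decidable P) → ∀ {x} → P x → x ∈ comprehension P?
  ∈-comprehension⁺ P? {x} px =
    lookup⇒[]= x _ (trans (lookup∘tabulate (does ∘ P?) x) (dec-true (P? x) px))

  ∈-comprehension⁻ : {P : Pred (Fin n) 0ℓ} (P? : Decidable P) → ∀ {x} → x ∈ comprehension P? → P x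
  ∈-comprehension⁻ P? {x} x∈ with P? x | trans (sym (lookup∘tabulate (does ∘ P?) x)) ([]=⇒lookup x∈)
  ... | yes px | _  = px
  ... | no _   | ()

  module _ {R : Rel (Fin n) 0ℓ} (R? : Decidable₂ R) (u : Fin n) where

    Closed : Subset n → Set
    Closed S = u ∈ S × (∀ {v w} → v ∈ S → R v w → w ∈ S)

    -- Grows a set of reached vertices by one violation of closure at a time; a finite vertex set
    -- allows no infinite growth. The closed set that results makes `Star R u` decidable.
    saturate : ∀ S → Acc _⊃_ S → u ∈ S → (∀ {v} → v ∈ S → Star R u v) →
               ∃ λ T → Closed T × (∀ {v} → v ∈ T → Star R u v)
    saturate S (acc rec) u∈S sound
      with any? (λ v → any? (λ w → (v ∈? S) ×-dec R? v w ×-dec ¬? (w ∈? S)))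
    ... | no ¬∃ = S , (u∈S , λ {v} {w} v∈S r →
            decidable-stable (w ∈? S) λ w∉S → ¬∃ (v , w , v∈S , r , w∉S)) , sound
    ... | yes (v , w , v∈S , r , w∉S) =
            saturate (S ∪ ⁅ w ⁆)
              (rec (x∈p∪q⁺ ∘ inj₁ , w , x∈p∪q⁺ (inj₂ (x∈⁅x⁆ w)) , w∉S))
              (x∈p∪q⁺ (inj₁ u∈S)) λ {z} z∈ → [ sound , reach {z} ]′ (x∈p∪q⁻ S ⁅ w ⁆ z∈)
      where
      reach : ∀ {z} → z ∈ ⁅ w ⁆ → Star R u z
      reach z∈ rewrite x∈⁅y⁆⇒x≡y w z∈ = sound v∈S ◅◅ r ◅ ε

    star? : ∀ v → Dec (Star R u v)
    star? v = map′ sound complete (v ∈? T)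
      where
      sat : ∃ λ T → Closed T × (∀ {v} → v ∈ T → Star R u v)
      sat = saturate ⁅ u ⁆ (⊃-wellFounded _) (x∈⁅x⁆ u) λ v∈ → subst (Star R u) (sym (x∈⁅y⁆⇒x≡y u v∈)) ε
      T = proj₁ sat
      sound : ∀ {v} → v ∈ T → Star R u v
      sound = proj₂ (proj₂ sat)
      extend : ∀ {v w} → v ∈ T → Star R v w → w ∈ T
      extend v∈ ε       = v∈
      extend v∈ (r ◅ s) = extend (proj₂ (proj₁ (proj₂ sat)) v∈ r) s
      complete : ∀ {v} → Star R u v → v ∈ T
      complete = extend (proj₁ (proj₁ (proj₂ sat)))

  module _ {P : Pred (Subset n) 0ℓ} (P? : Decidable P) where

    -- Descends to a proper subset with `P` as long as one exists; the search over all subsets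
    -- decides whether to stop.
    minimalBelow : ∀ V → Acc _⊂_ V → P V →
                   ∃ λ M → M ⊆ V × P M × (∀ {W} → P W → W ⊆ M → W ≡ M)
    minimalBelow V (acc rec) pV
      with anySubset? (λ W → P? W ×-dec all? (λ x → (x ∈? W) →-dec (x ∈? V)) ×-dec
                             any? (λ x → (x ∈? V) ×-dec ¬? (x ∈? W)))
    ... | no ¬∃ = V , id , pV , λ {W} pW W⊆V → ⊆-antisym W⊆V λ {x} x∈V →
            decidable-stable (x ∈? W) λ x∉W → ¬∃ (W , pW , (λ _ → W⊆V) , x , x∈V , x∉W)
    ... | yes (W , pW , W⊆V , x , x∈V , x∉W) =
            let M , M⊆W , rest = minimalBelow W (rec ((λ {x} → W⊆V x) , x , x∈V , x∉W)) pW
            in M , (λ x∈M → W⊆V _ (M⊆W x∈M)) , rest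

-- Walks

module _ {n : ℕ} where

  data Walk (R : Rel (Fin n) 0ℓ) : ℕ → Rel (Fin n) 0ℓ where
    []  : ∀ {u} → Walk R 0 u u
    _∷_ : ∀ {k u v w} → R u v → Walk R k v w → Walk R (suc k) u w

  infixr 5 _∷_

  module _ {R : Rel (Fin n) 0ℓ} where

    infixr 5 _++_
    infixl 5 _∷ʳ_

    _++_ : ∀ {j k u v w} → Walk R j u v → Walk R k v w → Walk R (j + k) u w
    []       ++ q = q
    (r ∷ p) ++ q = r ∷ (p ++ q)

    _∷ʳ_ : ∀ {k u v w} → Walk R k u v → R v w → Walk R (suc k) u w
    []      ∷ʳ s = s ∷ []
    (r ∷ p) ∷ʳ s = r ∷ (p ∷ʳ s)

    toStar : ∀ {k u v} → Walk R k u v → Star R u v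
    toStar []      = ε
    toStar (r ∷ p) = r ◅ toStar p

    fromStar : ∀ {u v} → Star R u v → ∃ λ k → Walk R k u v
    fromStar ε       = 0 , []
    fromStar (r ◅ s) = let k , p = fromStar s in suc k , r ∷ p

    at : ∀ {k u v} → Walk R k u v → Fin (suc k) → Fin n
    at {u = u} p   zero    = u
    at (_ ∷ p)     (suc i) = at p i

    at-last : ∀ {k u v} (p : Walk R k u v) → at p (fromℕ k) ≡ v
    at-last []      = refl
    at-last (_ ∷ p) = at-last p

    at-step : ∀ {k u v} (p : Walk R k u v) i → R (at p (inject₁ i)) (at p (suc i))
    at-step (r ∷ p) zero    = r
    at-step (r ∷ p) (suc i) = at-step p i

    at-∷ʳ : ∀ {k u v w} (p : Walk R k u v) (r : R v w) i → at (p ∷ʳ r) (inject₁ i) ≡ at p i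
    at-∷ʳ p       r zero    = refl
    at-∷ʳ (_ ∷ p) r (suc i) = at-∷ʳ p r i

    take : ∀ {k u v} (p : Walk R k u v) i → Walk R (toℕ i) u (at p i)
    take p       zero    = []
    take (r ∷ p) (suc i) = r ∷ take p i

    drop : ∀ {k u v} (p : Walk R k u v) i → Walk R (k ∸ toℕ i) (at p i) v
    drop p       zero    = p
    drop (_ ∷ p) (suc i) = drop p i

    unsnoc : ∀ {k u w} → Walk R (suc k) u w → ∃ λ v → Walk R k u v × R v w
    unsnoc (r ∷ [])          = _ , [] , r
    unsnoc (r ∷ p@(_ ∷ _)) = let v , q , s = unsnoc p in v , r ∷ q , s

    walk? : Decidable₂ R → ∀ k → Decidable₂ (Walk R k)
    walk? R? zero    u v = map′ (λ { refl → [] }) (λ { [] → refl }) (u ≟ v)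
    walk? R? (suc k) u v = map′ (λ { (w , r , p) → r ∷ p }) (λ { (r ∷ p) → _ , r , p })
                                (any? λ w → R? u w ×-dec walk? R? k w v)

    tabulateWalk : ∀ {k} (x : Fin (suc k) → Fin n) → (∀ i → R (x (inject₁ i)) (x (suc i))) →
                   Walk R k (x zero) (x (fromℕ k))
    tabulateWalk {zero}  x step = []
    tabulateWalk {suc k} x step = step zero ∷ tabulateWalk (x ∘ suc) (step ∘ suc)

    at-tabulateWalk : ∀ {k} (x : Fin (suc k) → Fin n) step i → at (tabulateWalk {k} x step) i ≡ x i
    at-tabulateWalk {zero}  x step zero    = refl
    at-tabulateWalk {suc k} x step zero    = refl
    at-tabulateWalk {suc k} x step (suc i) = at-tabulateWalk (x ∘ suc) (step ∘ suc) i

-- Counts m upwards with the distance k to the known witness as fuel.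
least : {P : Pred ℕ 0ℓ} → Decidable P → ∃ P → ∃ λ d → P d × (∀ {k} → P k → d ≤ k)
least {P} P? (k , pk) = go 0 k pk (λ _ → z≤n)
  where
  go : ∀ m k → P (m + k) → (∀ {j} → P j → m ≤ j) → ∃ λ d → P d × (∀ {k} → P k → d ≤ k)
  go m zero    p low = m , subst P (ℕₚ.+-identityʳ m) p , low
  go m (suc k) p low with P? m
  ... | yes pm = m , pm , low
  ... | no ¬pm = go (suc m) k (subst P (ℕₚ.+-suc m k) p)
                    λ {j} pj → ℕₚ.≤∧≢⇒< (low pj) λ { refl → ¬pm pj }

-- Connected sets

module _ {n : ℕ} (G : Graph n) where

  adj? : Decidable₂ (Adj G)
  adj? u v = adj G u v ≟ᵇ true

  adj-sym : Symmetric (Adj G)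
  adj-sym {u} {v} uv = trans (sym (Graph.symm G u v)) uv

  adj-irrefl : ∀ {u} → ¬ Adj G u u
  adj-irrefl {u} uu with trans (sym uu) (Graph.irrefl G u)
  ... | ()

  adjIn? : ∀ U → Decidable₂ (AdjIn G U)
  adjIn? U u v = (u ∈? U) ×-dec (v ∈? U) ×-dec adj? u v

  adjIn-sym : ∀ {U} → Symmetric (AdjIn G U)
  adjIn-sym (u∈ , v∈ , uv) = v∈ , u∈ , adj-sym uv

  connectedOn? : Decidable (ConnectedOn G)
  connectedOn? U = nonempty? U ×-dec map′ (λ f {u} {v} → f u v) (λ f u v → f {u} {v})
    (all? λ u → all? λ v → (u ∈? U) →-dec ((v ∈? U) →-dec star? (adjIn? U) u v))

  Star-∈ : ∀ {U u v} → Star (AdjIn G U) u v → u ∈ U → v ∈ U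
  Star-∈ ε                     u∈ = u∈
  Star-∈ ((_ , v∈ , _) ◅ s) u∈ = Star-∈ s v∈

  AdjIn⊆Adj : ∀ {U u v} → AdjIn G U u v → Adj G u v
  AdjIn⊆Adj (_ , _ , uv) = uv

  connectedOn-extend : ∀ {U w z} → ConnectedOn G U → z ∈ U → Adj G w z → ConnectedOn G (U ∪ ⁅ w ⁆)
  connectedOn-extend {U} {w} {z} (_ , conn) z∈U wz =
    (w , w∈) , λ u∈ v∈ → Star.reverse adjIn-sym (fromW u∈) ◅◅ fromW v∈
    where
    w∈ : w ∈ U ∪ ⁅ w ⁆
    w∈ = x∈p∪q⁺ (inj₂ (x∈⁅x⁆ w))
    inU : ∀ {x} → x ∈ U → x ∈ U ∪ ⁅ w ⁆
    inU x∈ = x∈p∪q⁺ (inj₁ x∈)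
    fromW : ∀ {v} → v ∈ U ∪ ⁅ w ⁆ → Star (AdjIn G (U ∪ ⁅ w ⁆)) w v
    fromW {v} v∈ with x∈p∪q⁻ U ⁅ w ⁆ v∈
    ... | inj₁ v∈U = (w∈ , inU z∈U , wz) ◅ Star.map (λ (a , b , ab) → inU a , inU b , ab) (conn z∈U v∈U)
    ... | inj₂ v∈w rewrite x∈⁅y⁆⇒x≡y w v∈w = ε

  module _ {R : Rel (Fin n) 0ℓ} (R? : Decidable₂ R) (u : Fin n) where

    component : Subset n
    component = comprehension (star? R? u)

    ∈-component⁺ : ∀ {v} → Star R u v → v ∈ component
    ∈-component⁺ = ∈-comprehension⁺ (star? R? u)

    ∈-component⁻ : ∀ {v} → v ∈ component → Star R u v
    ∈-component⁻ = ∈-comprehension⁻ (star? R? u)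

    -- A walk between two members stays in the component because `within` carries along the walk
    -- from u to its current vertex.
    component-connected : Symmetric R → (∀ {u v} → R u v → Adj G u v) → ConnectedOn G component
    component-connected R-sym R⊆Adj = (u , ∈-component⁺ ε) , λ v∈ w∈ →
      let s = ∈-component⁻ v∈ in
      within s (Star.reverse R-sym s ◅◅ ∈-component⁻ w∈)
      where
      within : ∀ {v w} → Star R u v → Star R v w → Star (AdjIn G component) v w
      within s ε       = ε
      within s (r ◅ t) = (∈-component⁺ s , ∈-component⁺ s′ , R⊆Adj r) ◅ within s′ t
        where s′ = s ◅◅ r ◅ ε

-- Crossing edges

module _ {n : ℕ} {G : Graph n} where

  infix 4 _∈ᵉ_

  _∈ᵉ_ : Fin n → Edge G → Set
  x ∈ᵉ e = x ≡ lo e ⊎ x ≡ hi e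

  ∈ᵉ-⊑ : ∀ {x e U} → x ∈ᵉ e → e ⊑ U → x ∈ U
  ∈ᵉ-⊑ (inj₁ refl) (l∈ , _) = l∈
  ∈ᵉ-⊑ (inj₂ refl) (_ , h∈) = h∈

  joinsˡ : ∀ {e u v} → Joins e u v → u ∈ᵉ e
  joinsˡ (inj₁ (refl , _)) = inj₁ refl
  joinsˡ (inj₂ (_ , refl)) = inj₂ refl

  joinsʳ : ∀ {e u v} → Joins e u v → v ∈ᵉ e
  joinsʳ (inj₁ (_ , refl)) = inj₂ refl
  joinsʳ (inj₂ (refl , _)) = inj₁ refl

  joins-swap : ∀ {e : Edge G} {u v} → Joins e u v → Joins e v u
  joins-swap (inj₁ p) = inj₂ p
  joins-swap (inj₂ p) = inj₁ p

  other : ∀ {e x} → x ∈ᵉ e → ∃ λ y → Joins e x y × Adj G x y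
  other {e} (inj₁ refl) = hi e , inj₁ (refl , refl) , Edge.adjacent e
  other {e} (inj₂ refl) = lo e , inj₂ (refl , refl) , adj-sym G (Edge.adjacent e)

  crosses-disjoint : ∀ {e f} → Crosses e f → ∀ {x} → x ∈ᵉ e → x ∈ᵉ f → ⊥
  crosses-disjoint (inj₁ (a , b , c)) (inj₁ p) (inj₁ q) = ℕₚ.<-irrefl (cong toℕ (trans (sym p) q)) a
  crosses-disjoint (inj₁ (a , b , c)) (inj₁ p) (inj₂ q) =
      ℕₚ.<-irrefl (cong toℕ (trans (sym p) q)) (ℕₚ.<-trans a (ℕₚ.<-trans b c))
  crosses-disjoint (inj₁ (a , b , c)) (inj₂ p) (inj₁ q) = ℕₚ.<-irrefl (cong toℕ (trans (sym q) p)) b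
  crosses-disjoint (inj₁ (a , b , c)) (inj₂ p) (inj₂ q) = ℕₚ.<-irrefl (cong toℕ (trans (sym p) q)) c
  crosses-disjoint (inj₂ (a , b , c)) (inj₁ p) (inj₁ q) = ℕₚ.<-irrefl (cong toℕ (trans (sym q) p)) a
  crosses-disjoint (inj₂ (a , b , c)) (inj₁ p) (inj₂ q) = ℕₚ.<-irrefl (cong toℕ (trans (sym p) q)) b
  crosses-disjoint (inj₂ (a , b , c)) (inj₂ p) (inj₁ q) =
      ℕₚ.<-irrefl (cong toℕ (trans (sym q) p)) (ℕₚ.<-trans a (ℕₚ.<-trans b c))
  crosses-disjoint (inj₂ (a , b , c)) (inj₂ p) (inj₂ q) = ℕₚ.<-irrefl (cong toℕ (trans (sym q) p)) c

  edge-connected : ∀ e → Σ (Subset n) λ U → ConnectedOn G U × e ⊑ U × (∀ {v} → v ∈ U → v ∈ᵉ e)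
  edge-connected e = ⁅ lo e ⁆ ∪ ⁅ hi e ⁆ ,
    connectedOn-extend G {⁅ lo e ⁆} singleton (x∈⁅x⁆ (lo e)) (adj-sym G (Edge.adjacent e)) ,
    (x∈p∪q⁺ (inj₁ (x∈⁅x⁆ _)) , x∈p∪q⁺ (inj₂ (x∈⁅x⁆ _))) ,
    λ v∈ → [ inj₁ ∘ x∈⁅y⁆⇒x≡y _ , inj₂ ∘ x∈⁅y⁆⇒x≡y _ ]′ (x∈p∪q⁻ ⁅ lo e ⁆ ⁅ hi e ⁆ v∈)
    where
    singleton : ConnectedOn G ⁅ lo e ⁆
    singleton = (lo e , x∈⁅x⁆ _) , λ u∈ v∈ →
        subst (Star _ _) (trans (x∈⁅y⁆⇒x≡y _ u∈) (sym (x∈⁅y⁆⇒x≡y _ v∈))) ε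

  Least : Edge G → Edge G → Subset n → Set
  Least e f M = ConnectedContaining G e f M × (∀ {V} → ConnectedContaining G e f V → M ⊆ V)

  least-swap : ∀ {e f M} → Least e f M → Least f e M
  least-swap ((c , e⊑ , f⊑) , low) = (c , f⊑ , e⊑) , λ (c′ , f⊑′ , e⊑′) → low (c′ , e⊑′ , f⊑′)

  separates? : ∀ x e f → Dec (Separates G x e f)
  separates? x e f = ((lo e ∈? ∁ ⁅ x ⁆) ×-dec (hi e ∈? ∁ ⁅ x ⁆)) ×-dec
    ((lo f ∈? ∁ ⁅ x ⁆) ×-dec (hi f ∈? ∁ ⁅ x ⁆)) ×-dec ¬? (star? (adjIn? G (∁ ⁅ x ⁆)) (lo e) (lo f))

  module _ (e f : Edge G) where

    connectedContaining? : Decidable (ConnectedContaining G e f)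
    connectedContaining? U = connectedOn? G U ×-dec ((lo e ∈? U) ×-dec (hi e ∈? U)) ×-dec
        ((lo f ∈? U) ×-dec (hi f ∈? U))

    private
      UniqueMinimal : Set
      UniqueMinimal = ∃ λ M → Minimal G (ConnectedContaining G e f) M ×
                      (∀ {V} → Minimal G (ConnectedContaining G e f) V → M ≡ V)

    -- Every connected set containing e and f has a minimal one below it, which by uniqueness is M.
    uniqueMinimal⇒least : UniqueMinimal → ∃ (Least e f)
    uniqueMinimal⇒least (M , (cM , _) , unique) = M , cM , λ {V} cV →
      let N , N⊆V , minN = minimalBelow connectedContaining? V (⊂-wellFounded V) cV
      in subst (_⊆ V) (sym (unique minN)) N⊆V

    least⇒uniqueMinimal : ∃ (Least e f) → UniqueMinimal
    least⇒uniqueMinimal (M , cM , low) =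
      M , (cM , λ cV V⊆M → ⊆-antisym V⊆M (low cV)) , λ (cV , minV) → minV cM (low cV)

    -- Grows the vertex set of a walk backwards from f, one vertex at a time, keeping it connected
    -- and inside Q. Once e is reached, `linked-finish` closes it up to a connected set containing
    -- both edges.
    Linked : Pred (Fin n) 0ℓ → Fin n → Set
    Linked Q z = ∃ λ U → ConnectedOn G U × z ∈ U × f ⊑ U × (∀ {v} → v ∈ U → Q v)

    module _ {Q : Pred (Fin n) 0ℓ} where

      linked-base : Q (lo f) → Q (hi f) → ∀ {b} → b ∈ᵉ f → Linked Q b
      linked-base ql qh b∈ =
        let U , conn , f⊑ , only = edge-connected f
        in U , conn , ∈ᵉ-⊑ {e = f} b∈ f⊑ , f⊑ , λ v∈ → [ (λ { refl → ql }) , (λ { refl → qh }) ]′ (only v∈)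

      linked-extend : ∀ {w z} → Q w → Adj G w z → Linked Q z → Linked Q w
      linked-extend {w} qw wz (U , conn , z∈ , (l∈ , h∈) , all) =
        U ∪ ⁅ w ⁆ , connectedOn-extend G conn z∈ wz , x∈p∪q⁺ (inj₂ (x∈⁅x⁆ w)) ,
        (x∈p∪q⁺ (inj₁ l∈) , x∈p∪q⁺ (inj₁ h∈)) ,
        λ v∈ → [ all , (λ v∈w → subst Q (sym (x∈⁅y⁆⇒x≡y w v∈w)) qw) ]′ (x∈p∪q⁻ U ⁅ w ⁆ v∈)

      linked-finish : Q (lo e) → Q (hi e) → ∀ {a} → a ∈ᵉ e → Linked Q a →
                      ∃ λ U → ConnectedContaining G e f U × (∀ {v} → v ∈ U → Q v)
      linked-finish ql qh {a} a∈ (U , conn , a∈U , (l∈ , h∈) , all) with other {e} a∈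
      ... | y , j , ay = V , (connectedOn-extend G conn a∈U (adj-sym G ay) , e⊑V j ,
                         (x∈p∪q⁺ (inj₁ l∈) , x∈p∪q⁺ (inj₁ h∈))) ,
          λ v∈ → [ all , (λ v∈y → subst Q (sym (x∈⁅y⁆⇒x≡y y v∈y)) (qy j)) ]′ (x∈p∪q⁻ U ⁅ y ⁆ v∈)
        where
        V = U ∪ ⁅ y ⁆
        y∈ : y ∈ V
        y∈ = x∈p∪q⁺ (inj₂ (x∈⁅x⁆ y))
        qy : ∀ {a y} → Joins e a y → Q y
        qy (inj₁ (_ , refl)) = qh
        qy (inj₂ (refl , _)) = ql
        e⊑V : Joins e a y → e ⊑ V
        e⊑V (inj₁ (p , q)) = subst (_∈ V) (sym p) (x∈p∪q⁺ (inj₁ a∈U)) , subst (_∈ V) (sym q) y∈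
        e⊑V (inj₂ (p , q)) = subst (_∈ V) (sym p) y∈ , subst (_∈ V) (sym q) (x∈p∪q⁺ (inj₁ a∈U))

-- Separating vertices and the least connected set

module _ {n : ℕ} {G : Graph n} (e f : Edge G) where

  -- With a walk of length d from e to f at hand, this makes d the distance between the two edges.
  Far : ℕ → Set
  Far d = ∀ {k a b} → a ∈ᵉ e → b ∈ᵉ f → Walk (Adj G) k a b → d ≤ k

  -- Only the source has to separate, so a `Star` of such steps may end on f.
  SepAdj : Fin n → Fin n → Set
  SepAdj v w = Separates G v e f × Adj G v w

  -- If V missed x, connectedness of V would join e and f in G without x.
  separates⇒∈ : ∀ {x V} → Separates G x e f → ConnectedContaining G e f V → x ∈ V
  separates⇒∈ {x} {V} (_ , _ , ¬s) ((_ , conn) , (l∈ , _) , (l′∈ , _)) =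
    decidable-stable (x ∈? V) λ x∉V →
      let avoid : ∀ {y} → y ∈ V → y ∈ ∁ ⁅ x ⁆
          avoid y∈V = x∉p⇒x∈∁p λ y∈x → x∉V (subst (_∈ V) (x∈⁅y⁆⇒x≡y x y∈x) y∈V)
      in ¬s (Star.map (λ (u∈ , v∈ , uv) → avoid u∈ , avoid v∈ , uv) (conn l∈ l′∈))

  -- The vertices a and b need not separate, since they lie on e and f and so in every set
  -- considered. Taking Q to be membership in all these sets makes the set that is built the least
  -- one.
  separating⇒least : ∀ {a z b} → a ∈ᵉ e → Adj G a z → Star SepAdj z b → b ∈ᵉ f → ∃ (Least e f)
  separating⇒least {a} {z} {b} a∈ az zb b∈ =
    let M , cM , low = linked-finish e f {Q} (λ (_ , (l∈ , _) , _) → l∈) (λ (_ , (_ , h∈) , _) → h∈) a∈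
                         (linked-extend e f {Q} (λ (_ , e⊑ , _) → ∈ᵉ-⊑ {e = e} a∈ e⊑) az (linked zb))
    in M , cM , λ cV v∈M → low v∈M cV
    where
    Q : Pred (Fin n) 0ℓ
    Q v = ∀ {V} → ConnectedContaining G e f V → v ∈ V
    linked : ∀ {z} → Star SepAdj z b → Linked e f Q z
    linked ε                  = linked-base e f {Q} (λ (_ , _ , l∈ , _) → l∈) (λ (_ , _ , _ , h∈) → h∈) b∈
    linked ((sep , zw) ◅ wb) = linked-extend e f {Q} (separates⇒∈ sep) zw (linked wb)

  -- If x did not separate e and f, the least connected set M would avoid x, while
  -- every vertex of M is on the given walk or in e or f, hence closer than x to e
  -- or closer than x to f; a step of M from the former to the latter kind would be
  -- part of a shortcut.
  least⇒separates : ∃ (Least e f) → ∀ {i j a x b} → a ∈ᵉ e → b ∈ᵉ f → 1 ≤ i → 1 ≤ j →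
                    Walk (Adj G) i a x → Walk (Adj G) j x b → Far (i + j) → Separates G x e f
  least⇒separates (M , (((_ , conn) , (le∈ , he∈) , (lf∈ , hf∈)) , low)) {suc i} {suc j}
      {a} {x} {b} a∈ b∈ _ _ p q far =
    (∉e (inj₁ refl) , ∉e (inj₂ refl)) , (∉f (inj₁ refl) , ∉f (inj₂ refl)) ,
    λ s → noShortcut (x∉M s)
    where
    -- Were x on e or on f, `q` or `p` alone would join the edges in too few steps, as the other
    -- walk has positive length.
    x∉e : ∀ {y} → y ∈ᵉ e → y ≢ x
    x∉e y∈ refl = ℕₚ.m+n≮n (suc i) (suc j) (ℕₚ.≤∧≢⇒< (far y∈ b∈ q) λ eq → ℕₚ.m≢1+n+m (suc j) {i} (sym eq))
    x∉f : ∀ {y} → y ∈ᵉ f → y ≢ x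
    x∉f y∈ refl = ℕₚ.m+1+n≰m (suc i) (far a∈ y∈ p)
    ∉e : ∀ {y} → y ∈ᵉ e → y ∈ ∁ ⁅ x ⁆
    ∉e y∈ = x∉p⇒x∈∁p (x∉e y∈ ∘ x∈⁅y⁆⇒x≡y x)
    ∉f : ∀ {y} → y ∈ᵉ f → y ∈ ∁ ⁅ x ⁆
    ∉f y∈ = x∉p⇒x∈∁p (x∉f y∈ ∘ x∈⁅y⁆⇒x≡y x)

    -- The component of e in G without x is now itself a connected set containing e and f, so M lies
    -- in it.
    x∉M : Star (AdjIn G (∁ ⁅ x ⁆)) (lo e) (lo f) → x ∉ M
    x∉M s x∈M = x∈p⇒x∉∁p (x∈⁅x⁆ x) (Star-∈ G (∈-component⁻ G R? (lo e) (low cC x∈M)) (∉e (inj₁ refl)))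
      where
      R? = adjIn? G (∁ ⁅ x ⁆)
      C = component G R? (lo e)
      inC : ∀ {v} → Star (AdjIn G (∁ ⁅ x ⁆)) (lo e) v → v ∈ C
      inC = ∈-component⁺ G R? (lo e)
      cC : ConnectedContaining G e f C
      cC = component-connected G R? (lo e) (adjIn-sym G) (AdjIn⊆Adj G) ,
           (inC ε , inC ((∉e (inj₁ refl) , ∉e (inj₂ refl) , Edge.adjacent e) ◅ ε)) ,
           (inC s , inC (s ◅◅ (∉f (inj₁ refl) , ∉f (inj₂ refl) , Edge.adjacent f) ◅ ε))

    -- Here i and j are one less than the lengths of `p` and `q`: a step from `Left` to `Right`
    -- gives a walk of length at most i + 1 + j, one below the bound of `far`.
    Left Right Q : Pred (Fin n) 0ℓ
    Left  v = ∃₂ λ k a′ → k ≤ i × a′ ∈ᵉ e × Walk (Adj G) k a′ v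
    Right v = ∃₂ λ k b′ → k ≤ j × b′ ∈ᵉ f × Walk (Adj G) k v b′
    Q v = v ≡ x ⊎ Left v ⊎ Right v

    shortcut : ∀ {k l a′ b′} → a′ ∈ᵉ e → b′ ∈ᵉ f → k ≤ i → l ≤ suc j → ¬ Walk (Adj G) (k + l) a′ b′
    shortcut a′∈ b′∈ k≤ l≤ w = ℕₚ.1+n≰n (ℕₚ.≤-trans (far a′∈ b′∈ w) (ℕₚ.+-mono-≤ k≤ l≤))

    toF : ∀ {k v} → Walk (Adj G) k v b → k ≤ j → Linked e f Q v
    toF []      _  = linked-base e f {Q} (inj₂ (inj₂ (0 , lo f , z≤n , inj₁ refl , [])))
                                          (inj₂ (inj₂ (0 , hi f , z≤n , inj₂ refl , []))) b∈
    toF (r ∷ w) k≤ = linked-extend e f {Q} (inj₂ (inj₂ (_ , b , k≤ , b∈ , r ∷ w))) r (toF w (ℕₚ.<⇒≤ k≤))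

    fromX : ∀ {z} → Walk (Adj G) (suc j) x z → z ≡ b → Linked e f Q x
    fromX (r ∷ w) refl = linked-extend e f {Q} (inj₁ refl) r (toF w ℕₚ.≤-refl)

    fromE : ∀ {k l v} → Walk (Adj G) k a v → Walk (Adj G) l v x → k + l ≡ suc i → Linked e f Q v
    fromE w [] _ = fromX q refl
    fromE {k} {suc l} w (r ∷ w′) eq = linked-extend e f {Q}
      (inj₂ (inj₁ (k , a , ℕₚ.≤-trans (ℕₚ.m≤m+n k l)
          (ℕₚ.≤-reflexive (ℕₚ.suc-injective (trans (sym (ℕₚ.+-suc k l)) eq))) , a∈ , w)))
      r (fromE (w ∷ʳ r) w′ (trans (sym (ℕₚ.+-suc k l)) eq))

    M⊆Q : ∀ {v} → v ∈ M → Q v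
    M⊆Q = let U , cU , all = linked-finish e f {Q} (inj₂ (inj₁ (0 , lo e , z≤n , inj₁ refl , [])))
                               (inj₂ (inj₁ (0 , hi e , z≤n , inj₂ refl , []))) a∈ (fromE [] p refl)
          in all ∘ low cU

    noShortcut : x ∉ M → ⊥
    noShortcut x∉ =
      -- A walk in M from e to f can never leave `Left`, but `lo f` being in `Left` is again a walk
      -- that is too short.
      let k , a′ , k≤ , a′∈ , w = stayLeft (0 , lo e , z≤n , inj₁ refl , []) (conn le∈ lf∈)
      in shortcut a′∈ (inj₁ refl) k≤ z≤n (subst (λ m → Walk (Adj G) m a′ (lo f)) (sym (ℕₚ.+-identityʳ k)) w)
      where
      stayLeft : ∀ {u v} → Left u → Star (AdjIn G M) u v → Left v
      stayLeft l ε = l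
      stayLeft l@(k , a′ , k≤ , a′∈ , w) (_◅_ {j = y} (_ , y∈ , uy) s) with M⊆Q y∈
      ... | inj₁ refl = contradiction y∈ x∉
      ... | inj₂ (inj₁ l′) = stayLeft l′ s
      ... | inj₂ (inj₂ (k′ , b′ , k′≤ , b′∈ , w′)) = ⊥-elim (shortcut a′∈ b′∈ k≤ (s≤s k′≤) (w ++ uy ∷ w′))

-- Paths between crossing edges

private
  -- On a path x₀ … x_{2+d} whose end edges are e and f, the vertex x_i is at distance at
  -- most i ∸ 1 from e and x_j at distance at most 1 + d ∸ j from f.
  noShortcut : ∀ {d i j} → 1 ≤ d → 2 + i ≤ j → j ≤ 2 + d → ¬ d ≤ (i ∸ 1) + (1 + d ∸ j)
  -- Truncated subtraction gives the end vertices, x₀ on e and x_{2+d} on f, distance 0; hence the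
  -- separate cases i = 0 and j = 2 + d.
  noShortcut {suc d} {zero}  {suc zero}    _ (s≤s ())
  noShortcut {suc d} {zero}  {suc (suc j)} _ _ j≤ d≤ = ℕₚ.1+n≰n (ℕₚ.≤-trans d≤ (ℕₚ.m∸n≤m d j))
  noShortcut {d} {suc i} {j} _ i<j j≤ d≤ with ℕₚ.m≤n⇒m<n∨m≡n j≤
  ... | inj₂ refl = ℕₚ.1+n≰n (ℕₚ.≤-trans (ℕ.s≤s⁻¹ (ℕ.s≤s⁻¹ i<j)) (ℕₚ.≤-trans d≤ (ℕₚ.≤-reflexive
        (trans (cong (i +_) (ℕₚ.m≤n⇒m∸n≡0 (ℕₚ.n≤1+n (suc d)))) (ℕₚ.+-identityʳ i)))))
  ... | inj₁ j<2+d = ℕₚ.1+n≰n {suc i} (ℕₚ.≤-trans (ℕₚ.<⇒≤ i<j) (ℕₚ.+-cancelˡ-≤ d j (suc i) (begin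
        d + j                       ≤⟨ ℕₚ.+-monoˡ-≤ j d≤ ⟩
        i + (1 + d ∸ j) + j         ≡⟨ ℕₚ.+-assoc i _ j ⟩
        i + ((1 + d ∸ j) + j)       ≡⟨ cong (i +_) (ℕₚ.m∸n+n≡m (ℕ.s≤s⁻¹ j<2+d)) ⟩
        i + suc d                   ≡⟨ ℕₚ.+-suc i d ⟩
        suc i + d                   ≡⟨ ℕₚ.+-comm (suc i) d ⟩
        d + suc i                   ∎)))
    where open ℕₚ.≤-Reasoning

module _ {n : ℕ} {G : Graph n} {e f : Edge G} (cross : Crosses e f) where

  private
    disjoint : ∀ {x} → x ∈ᵉ e → x ∈ᵉ f → ⊥
    disjoint = crosses-disjoint {e = e} {f} cross

  -- With one or two steps, x₀ or x₁ would lie on both edges, but crossing edges are disjoint.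
  length≥3 : (P : PathBetween e f) → 3 ≤ length P
  length≥3 record { m = 0 ; first = first ; last = last } =
    ⊥-elim (disjoint (joinsˡ {e = e} first) (joinsˡ {e = f} last))
  length≥3 record { m = 1 ; first = first ; last = last } =
    ⊥-elim (disjoint (joinsʳ {e = e} first) (joinsˡ {e = f} last))
  length≥3 record { m = suc (suc m) } = s≤s (s≤s (s≤s z≤n))

  -- The walk is prolonged at both ends by the other endpoints of e and f. Equal vertices at
  -- consecutive positions would be a loop of G, and at other positions would allow a shortcut from
  -- e to f.
  far⇒path : ∀ {d a b} → a ∈ᵉ e → b ∈ᵉ f → Walk (Adj G) d a b → Far e f d →
             Σ (PathBetween e f) λ P → length P ≡ 2 + d
  far⇒path {d} {a} {b} a∈ b∈ w far with other {e = e} a∈ | other {e = f} b∈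
  ... | a′ , ja , aa′ | b′ , jb , bb′ = record
    { m         = suc d
    ; vertex    = at W
    ; injective = λ {i} {j} → inj i j
    ; step      = at-step W
    ; first     = joins-swap {e = e} ja
    ; last      = subst₂ (Joins f) (sym (trans (at-∷ʳ (a′a ∷ w) bb′ (fromℕ (suc d))) (at-last (a′a ∷ w))))
        (sym (at-last W)) jb
    } , refl
    where
    a′a = adj-sym G aa′
    W : Walk (Adj G) (2 + d) a′ b′
    W = a′a ∷ (w ∷ʳ bb′)

    fromE : ∀ i → ∃ λ y → y ∈ᵉ e × Walk (Adj G) (toℕ i ∸ 1) y (at W i)
    fromE zero    = a′ , joinsʳ {e = e} ja , []
    fromE (suc i) = a , a∈ , take (w ∷ʳ bb′) i

    toF : ∀ i → ∃ λ y → y ∈ᵉ f × Walk (Adj G) (suc d ∸ toℕ i) (at W i) y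
    toF i with view i
    ... | ‵fromℕ = b′ , joinsʳ {e = f} jb ,
      subst₂ (λ k v → Walk (Adj G) k v b′)
             (sym (trans (cong (suc d ∸_) (toℕ-fromℕ (2 + d))) (ℕₚ.m≤n⇒m∸n≡0 (ℕₚ.n≤1+n (suc d)))))
             (sym (at-last W)) []
    ... | ‵inject₁ i′ = b , b∈ ,
      subst₂ (λ k v → Walk (Adj G) (suc d ∸ k) v b)
             (sym (toℕ-inject₁ i′)) (sym (at-∷ʳ (a′a ∷ w) bb′ i′)) (drop (a′a ∷ w) i′)

    1≤d : ∀ {d} → Walk (Adj G) d a b → 1 ≤ d
    1≤d []      = ⊥-elim (disjoint a∈ b∈)
    1≤d (_ ∷ _) = s≤s z≤n

    distinct : ∀ i j → toℕ i < toℕ j → at W i ≢ at W j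
    distinct i (suc j) i<j eq with ℕₚ.m≤n⇒m<n∨m≡n i<j
    ... | inj₂ 1+i≡1+j = adj-irrefl G
        (subst (Adj G (at W i)) (sym eq)
        (subst (λ k → Adj G (at W k) (at W (suc j)))
        (toℕ-injective (trans (toℕ-inject₁ j) (sym (ℕₚ.suc-injective 1+i≡1+j)))) (at-step W j)))
    ... | inj₁ 2+i≤j =
      let y , y∈ , p = fromE i
          z , z∈ , q = toF (suc j)
      in noShortcut (1≤d w) 2+i≤j (ℕ.s≤s⁻¹ (toℕ<n (suc j)))
           (far y∈ z∈ (p ++ subst (λ v → Walk (Adj G) _ v z) (sym eq) q))

    inj : ∀ i j → at W i ≡ at W j → i ≡ j
    inj i j eq with ℕₚ.<-cmp (toℕ i) (toℕ j)
    ... | tri< i<j _ _ = contradiction eq (distinct i j i<j)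
    ... | tri≈ _ i≡j _ = toℕ-injective i≡j
    ... | tri> _ _ i>j = contradiction (sym eq) (distinct j i i>j)

  nearest : ∀ {k a b} → a ∈ᵉ e → b ∈ᵉ f → Walk (Adj G) k a b →
            ∃ λ d → (∃₂ λ a b → a ∈ᵉ e × b ∈ᵉ f × Walk (Adj G) d a b) × Far e f d
  nearest {k} {a} {b} a∈ b∈ w =
    let d , linked , low = least linked? (k , a , b , a∈ , b∈ , w)
    in d , linked , λ a∈ b∈ w → low (_ , _ , a∈ , b∈ , w)
    where
    linked? : Decidable λ k → ∃₂ λ a b → a ∈ᵉ e × b ∈ᵉ f × Walk (Adj G) k a b
    linked? k = any? λ a → any? λ b →
      ((a ≟ lo e) ⊎-dec (a ≟ hi e)) ×-dec ((b ≟ lo f) ⊎-dec (b ≟ hi f)) ×-dec walk? (adj? G) k a b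

  -- The given walk may repeat vertices or meet e and f early, so a nearest one is prolonged
  -- instead.
  path-within : ∀ {k a b} → a ∈ᵉ e → b ∈ᵉ f → Walk (Adj G) k a b →
                Σ (PathBetween e f) λ P → length P ≤ 2 + k
  path-within a∈ b∈ w =
    let d , (_ , _ , a∈′ , b∈′ , w′) , far = nearest a∈ b∈ w
        P , ∣P∣≡ = far⇒path a∈′ b∈′ w′ far
    in P , ℕₚ.≤-trans (ℕₚ.≤-reflexive ∣P∣≡) (s≤s (s≤s (far a∈ b∈ w)))

  -- Undoes the prolongation of `far⇒path`: both end vertices are dropped, so position i of the path
  -- becomes position i - 1 of the walk.
  innerWalk : (P : PathBetween e f) → ∃ λ d → length P ≡ 2 + d × ∃₂ λ a b → a ∈ᵉ e × b ∈ᵉ f ×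
    Σ (Walk (Adj G) d a b) λ w → ∀ i → 2 ≤ toℕ i → toℕ i ≤ d → ∃ λ j →
        suc (toℕ j) ≡ toℕ i × at w j ≡ vertex P i
  innerWalk record { m = zero ; first = first ; last = last } =
    ⊥-elim (disjoint (joinsˡ {e = e} first) (joinsˡ {e = f} last))
  innerWalk record { m = suc d ; vertex = x ; step = step ; first = first ; last = last } =
    d , refl , _ , _ , joinsʳ {e = e} first , joinsˡ {e = f} last , w , index
    where
    y : Fin (suc d) → Fin n
    y i = x (suc (inject₁ i))
    w : Walk (Adj G) d (y zero) (y (fromℕ d))
    w = tabulateWalk y λ i → step (suc (inject₁ i))
    index : ∀ i → 2 ≤ toℕ i → toℕ i ≤ d → ∃ λ j → suc (toℕ j) ≡ toℕ i × at w j ≡ x i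
    index (suc i) _ i<d with view i
    ... | ‵fromℕ     = contradiction (subst (_< d) (toℕ-fromℕ (suc d)) i<d) (ℕₚ.<⇒≯ ℕₚ.≤-refl)
    ... | ‵inject₁ j = j , cong suc (sym (toℕ-inject₁ j)) , at-tabulateWalk y _ j

  shortest⇒far : ∀ (P : PathBetween e f) {d} → length P ≡ 2 + d →
                 ((Q : PathBetween e f) → length P ≤ length Q) → Far e f d
  shortest⇒far P ∣P∣≡ short a∈ b∈ w =
    let Q , ∣Q∣≤ = path-within a∈ b∈ w
    in ℕ.s≤s⁻¹ (ℕ.s≤s⁻¹ (ℕₚ.≤-trans (subst (_≤ length Q) ∣P∣≡ (short Q)) ∣Q∣≤))

  least⇒passes : ∃ (Least e f) → ∀ (P : PathBetween e f) → ((Q : PathBetween e f) → length P ≤ length Q) →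
                 ∀ i → 2 ≤ toℕ i → toℕ i ≤ length P ∸ 2 → Separates G (vertex P i) e f
  least⇒passes least P short i 2≤i i≤ with innerWalk P
  ... | d , ∣P∣≡ , a , b , a∈ , b∈ , w , index
    with i≤d ← subst (λ k → toℕ i ≤ k ∸ 2) ∣P∣≡ i≤
    with j , 1+j≡i , at≡ ← index i 2≤i i≤d =
    -- The walk is cut at x_i; the range 2 ≤ i ≤ k - 2 is exactly what makes both pieces nonempty.
    subst (λ v → Separates G v e f) at≡
      (least⇒separates e f least a∈ b∈ (ℕ.s≤s⁻¹ (subst (2 ≤_) (sym 1+j≡i) 2≤i)) (ℕₚ.m<n⇒0<n∸m j<d)
        (take w j) (drop w j) (subst (Far e f) (sym (ℕₚ.m+[n∸m]≡n (ℕₚ.<⇒≤ j<d))) (shortest⇒far P ∣P∣≡ short)))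
    where
    j<d : toℕ j < d
    j<d = subst (_≤ d) (sym 1+j≡i) i≤d

  passes⇒least : (P : PathBetween e f) →
                 (∀ i → 2 ≤ toℕ i → toℕ i ≤ length P ∸ 2 → Separates G (vertex P i) e f) → ∃ (Least e f)
  passes⇒least P@record { m = zero } _ = contradiction (length≥3 P) λ { (s≤s ()) }
  passes⇒least P@record { m = suc zero } _ = contradiction (length≥3 P) λ { (s≤s (s≤s ())) }
  passes⇒least record { m = suc (suc d) ; vertex = x ; step = step ; first = first ; last = last } sep =
    separating⇒least e f (joinsʳ {e = e} first) (step (suc zero))
      (toStar (tabulateWalk y λ i → sep (suc (suc (inject₁ (inject₁ i)))) (s≤s (s≤s z≤n)) (s≤s (bound i)) ,
          step (suc (suc (inject₁ i)))))
      (joinsˡ {e = f} last)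
    where
    -- Here k = 3 + d and `y` lists x₂ ... x_{k-1}: all but the last are in the checked range, and
    -- the last lies on f. For k = 3 nothing is left to check.
    y : Fin (suc d) → Fin n
    y i = x (suc (suc (inject₁ i)))
    bound : ∀ (i : Fin d) → suc (toℕ (inject₁ (inject₁ i))) ≤ d
    bound i = subst (_< d) (sym (trans (toℕ-inject₁ (inject₁ i)) (toℕ-inject₁ i))) (toℕ<n i)

  joined⇒path : Star (Adj G) (lo e) (lo f) → PathBetween e f
  joined⇒path s = proj₁ (path-within (inj₁ refl) (inj₁ refl) (proj₂ (fromStar s)))

  path⇒joined : PathBetween e f → Star (Adj G) (lo e) (lo f)
  path⇒joined P with innerWalk P
  ... | _ , _ , _ , _ , a∈ , b∈ , w , _ = fromE a∈ ◅◅ toStar w ◅◅ Star.reverse (adj-sym G) (fromF b∈)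
    where
    fromE : ∀ {a} → a ∈ᵉ e → Star (Adj G) (lo e) a
    fromE (inj₁ refl) = ε
    fromE (inj₂ refl) = Edge.adjacent e ◅ ε
    fromF : ∀ {b} → b ∈ᵉ f → Star (Adj G) (lo f) b
    fromF (inj₁ refl) = ε
    fromF (inj₂ refl) = Edge.adjacent f ◅ ε

  shortestPath⊎none : ShortestPath G e f ⊎ ¬ PathBetween e f
  shortestPath⊎none with star? (adj? G) (lo e) (lo f)
  ... | no ¬s = inj₂ (¬s ∘ path⇒joined)
  ... | yes s =
    let d , (_ , _ , a∈ , b∈ , w) , far = nearest (inj₁ refl) (inj₁ refl) (proj₂ (fromStar s))
        P , ∣P∣≡ = far⇒path a∈ b∈ w far
    in inj₁ (P , λ Q → let _ , ∣Q∣≡ , _ , _ , a∈′ , b∈′ , w′ , _ = innerWalk Q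
                       in subst₂ _≤_ (sym ∣P∣≡) (sym ∣Q∣≡) (s≤s (s≤s (far a∈′ b∈′ w′))))

  fails? : (x : ShortestPath G e f ⊎ ¬ PathBetween e f) → Dec (Fails G x)
  fails? (inj₂ _) = yes _
  fails? (inj₁ (P , _)) = (4 ℕₚ.≤? length P) ×-dec
    any? λ i → (2 ℕₚ.≤? toℕ i) ×-dec (toℕ i ℕₚ.≤? length P ∸ 2) ×-dec ¬? (separates? (vertex P i) e f)

  fails⇒¬least : (x : ShortestPath G e f ⊎ ¬ PathBetween e f) → Fails G x → ¬ ∃ (Least e f)
  fails⇒¬least (inj₂ ¬P) _ (_ , ((_ , conn) , (l∈ , _) , (l′∈ , _)) , _) =
    ¬P (joined⇒path (Star.map (AdjIn⊆Adj G) (conn l∈ l′∈)))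
  fails⇒¬least (inj₁ (P , short)) (_ , i , 2≤i , i≤ , ¬sep) least = ¬sep (least⇒passes least P short i 2≤i i≤)

  ¬fails⇒least : (x : ShortestPath G e f ⊎ ¬ PathBetween e f) → ¬ Fails G x → ∃ (Least e f)
  ¬fails⇒least (inj₂ _) ¬fails = contradiction _ ¬fails
  ¬fails⇒least (inj₁ (P , _)) ¬fails = passes⇒least P λ i 2≤i i≤ →
    decidable-stable (separates? (vertex P i) e f) λ ¬sep →
      -- The clause k ≥ 4 of `Fails` follows from 2 ≤ i ≤ k - 2.
      ¬fails (ℕₚ.≤-trans (s≤s (s≤s 2≤i))
          (ℕₚ.≤-trans (s≤s (s≤s i≤)) (ℕₚ.≤-reflexive (ℕₚ.m+[n∸m]≡n {2} (ℕₚ.<⇒≤ (length≥3 P))))) ,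
          i , 2≤i , i≤ , ¬sep)

module _ {n : ℕ} (G : Graph n) where

  someRun : Run G
  someRun e f c = shortestPath⊎none {e = e} {f} c

  ¬least⇒no : ∀ (r : Run G) e f → Crosses e f → ¬ ∃ (Least e f) → Outputs G r No
  ¬least⇒no r e f c ¬least = e , f , c , decidable-stable (fails? c (r e f c))
      (¬least ∘ ¬fails⇒least c (r e f c))

  -- Both sides say that every crossing pair has a least set, a condition in which the chosen paths
  -- do not occur.
  outputsYes⇔crossingClosed : ∀ (r : Run G) → Outputs G r Yes ⇔ CrossingClosed G
  outputsYes⇔crossingClosed r = mk⇔
    (λ ¬no e f c → least⇒uniqueMinimal e f (¬fails⇒least c (r e f c) λ fails → ¬no (e , f , c , fails)))
    (λ closed (e , f , c , fails) → fails⇒¬least c (r e f c) fails (uniqueMinimal⇒least e f (closed e f c)))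

-- The noncrossing bond poset

does-sound : ∀ {A : Set} (a? : Dec A) → does a? ≡ true → A
does-sound (yes a) _ = a

module _ {n : ℕ} where

  decGraph : {R : Rel (Fin n) 0ℓ} → Decidable₂ R → Symmetric R → (∀ {u} → ¬ R u u) → Graph n
  decGraph R? R-sym R-irrefl = record
    { adj    = λ u v → does (R? u v)
    ; symm   = λ u v → does-⇔ (mk⇔ R-sym R-sym) (R? u v) (R? v u)
    ; irrefl = λ u → dec-false (R? u u) R-irrefl
    }

  _inside_,_ : Fin n → Fin n → Fin n → Set
  x inside p , q = p Fin.< x × x Fin.< q

  -- A discrete intermediate value argument: the first step out of the interval jumps over p or q,
  -- because it cannot land on them.
  exit : {R : Rel (Fin n) 0ℓ} → ∀ {p q s t} → s inside p , q → ¬ t inside p , q →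
         (∀ {z} → Star R s z → z ≢ p × z ≢ q) → Star R s t →
         ∃₂ λ z w → Star R s z × R z w × z inside p , q × (w Fin.< p ⊎ q Fin.< w)
  exit inside ¬inside avoid ε = contradiction inside ¬inside
  exit {p = p} {q} {s} inside ¬inside avoid (_◅_ {j = w} r rs) with <-cmp w p | <-cmp w q
  ... | tri< w<p _ _ | _ = s , w , ε , r , inside , inj₁ w<p
  ... | tri≈ _ w≡p _ | _ = contradiction w≡p (proj₁ (avoid (r ◅ ε)))
  ... | tri> _ _ p<w | tri> _ _ q<w = s , w , ε , r , inside , inj₂ q<w
  ... | tri> _ _ p<w | tri≈ _ w≡q _ = contradiction w≡q (proj₂ (avoid (r ◅ ε)))
  ... | tri> _ _ p<w | tri< w<q _ _ =
    let z , w′ , ss , rest = exit (p<w , w<q) ¬inside (avoid ∘ (r ◅_)) rs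
    in z , w′ , r ◅ ss , rest

module _ {n : ℕ} {G : Graph n} where

  edge : ∀ {u v} → u Fin.< v → Adj G u v → Edge G
  edge {u} {v} u<v uv = record { lo = u ; hi = v ; lo<hi = u<v ; adjacent = uv }

  module _ {H : Graph n} (H⊆G : ∀ {u v} → Adj H u v → Adj G u v) where

    private
      _~_ = SameComponent H
      ~-sym : Symmetric _~_
      ~-sym = Star.reverse (adj-sym H)

    crossingEdge : ∀ (e : Edge G) {s t} → s inside lo e , hi e → ¬ t inside lo e , hi e → ¬ s ~ lo e →
                   Adj H (lo e) (hi e) → s ~ t →
                   ∃ λ (f : Edge G) → Crosses e f × Adj H (lo f) (hi f) × s ~ lo f
    crossingEdge e {s} inside ¬inside s≁e e∈H st
      with exit inside ¬inside (λ sz → (λ { refl → s≁e sz }) ,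
          (λ { refl → s≁e (sz ◅◅ adj-sym H e∈H ◅ ε) })) st
    ... | z , w , sz , zw , (p<z , z<q) , inj₁ w<p =
      edge (<-trans w<p p<z) (H⊆G (adj-sym H zw)) , inj₂ (w<p , p<z , z<q) , adj-sym H zw , sz ◅◅ zw ◅ ε
    ... | z , w , sz , zw , (p<z , z<q) , inj₂ q<w =
      edge (<-trans z<q q<w) (H⊆G zw) , inj₁ (p<z , z<q , q<w) , zw , sz

    -- A walk from c to a leaves the interval (b, d) along an edge e, and exactly one of b and d
    -- then lies under e. A walk between b and d therefore leaves the interval of e along an edge f
    -- that crosses it.
    crossingEdges : ∀ {a b c d} → a Fin.< b → b Fin.< c → c Fin.< d → a ~ c → b ~ d → ¬ a ~ b →
                    ∃₂ λ (e f : Edge G) → Crosses e f × Adj H (lo e) (hi e) × Adj H (lo f) (hi f) ×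
                                          a ~ lo e × b ~ lo f
    crossingEdges {a} {b} {c} {d} a<b b<c c<d ac bd a≁b
      with exit (b<c , c<d) (λ (b<a , _) → ℕₚ.<-asym a<b b<a)
                (λ cz → (λ { refl → a≁b (ac ◅◅ cz) }) , (λ { refl → a≁b (ac ◅◅ cz ◅◅ ~-sym bd) })) (~-sym ac)
    ... | z , w , cz , zw , (b<z , z<d) , inj₁ w<b =
      let e = edge (<-trans w<b b<z) (H⊆G (adj-sym H zw))
          aw = ac ◅◅ cz ◅◅ zw ◅ ε
          f , e×f , f∈H , bf = crossingEdge e (w<b , b<z) (λ (_ , d<z) → ℕₚ.<-asym z<d d<z)
                                 (λ bw → a≁b (aw ◅◅ ~-sym bw)) (adj-sym H zw) bd
      in e , f , e×f , adj-sym H zw , f∈H , aw , bf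
    ... | z , w , cz , zw , (b<z , z<d) , inj₂ d<w =
      let e = edge (<-trans z<d d<w) (H⊆G zw)
          az = ac ◅◅ cz
          f , e×f , f∈H , df = crossingEdge e (z<d , d<w) (λ (z<b , _) → ℕₚ.<-asym z<b b<z)
                                 (λ dz → a≁b (az ◅◅ ~-sym (bd ◅◅ dz))) zw (~-sym bd)
      in e , f , e×f , zw , f∈H , az , bd ◅◅ df

-- Blocks, intersections of bonds and the lattice property

module _ {n : ℕ} (G : Graph n) where

  open NCBond

  private
    _≼_ = Poset._≤_ (NC G)

  crossing-sameComponent : (S : NCBond G) → ∀ (e f : Edge G) → Crosses e f →
    Adj (graph S) (lo e) (hi e) → Adj (graph S) (lo f) (hi f) → SameComponent (graph S) (lo e) (lo f)
  crossing-sameComponent S e f (inj₁ (p , q , r)) e∈S f∈S = noncrossing S p q r (e∈S ◅ ε) (f∈S ◅ ε)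
  crossing-sameComponent S e f (inj₂ (p , q , r)) e∈S f∈S =
    Star.reverse (adj-sym (graph S)) (noncrossing S p q r (f∈S ◅ ε) (e∈S ◅ ε))

  block : NCBond G → Fin n → Subset n
  block S u = component G (adj? (graph S)) u

  block⁺ : ∀ S {u v} → SameComponent (graph S) u v → v ∈ block S u
  block⁺ S {u} = ∈-component⁺ G (adj? (graph S)) u

  block⁻ : ∀ S {u v} → v ∈ block S u → SameComponent (graph S) u v
  block⁻ S {u} = ∈-component⁻ G (adj? (graph S)) u

  block-contains : (S : NCBond G) → ∀ (e f : Edge G) → Crosses e f →
    Adj (graph S) (lo e) (hi e) → Adj (graph S) (lo f) (hi f) → ConnectedContaining G e f (block S (lo e))
  block-contains S e f e×f e∈S f∈S =
    component-connected G (adj? (graph S)) (lo e) (adj-sym (graph S)) (subgraph S) ,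
    (block⁺ S ε , block⁺ S (e∈S ◅ ε)) , (block⁺ S ef , block⁺ S (ef ◅◅ f∈S ◅ ε))
    where ef = crossing-sameComponent S e f e×f e∈S f∈S

  -- Given by its universal property, apart from how membership is decided. `∩-glb` asks for an edge
  -- of G so that the empty family has intersection G.
  record Intersection (F : NCBond G → Set) : Set where
    field
      graph∩   : Graph n
      ∩-⊆G     : ∀ {u v} → Adj graph∩ u v → Adj G u v
      ∩-lower  : ∀ {S} → F S → ∀ {u v} → Adj graph∩ u v → Adj (graph S) u v
      ∩-glb    : ∀ {u v} → Adj G u v → (∀ {S} → F S → Adj (graph S) u v) → Adj graph∩ u v

  -- Crossing components of the intersection contain crossing edges e and f; each bond
  -- of the family has e and f in one block, hence contains all edges of G[M] for the
  -- least connected set M containing e and f, and so does the intersection.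
  ⋂ : CrossingClosed G → ∀ {F} → Intersection F → NCBond G
  ⋂ closed {F} I = record
    { graph       = graph∩
    ; subgraph    = ∩-⊆G
    ; induced     = λ uv adj → ∩-glb adj λ {S} S∈F → induced S (Star.map (∩-lower {S} S∈F) uv) adj
    ; noncrossing = λ {a} {b} a<b b<c c<d ac bd → decidable-stable (star? (adj? graph∩) a b) λ a≁b →
        let e , f , e×f , e∈ , f∈ , ae , bf = crossingEdges {H = graph∩} ∩-⊆G a<b b<c c<d ac bd a≁b
        in a≁b (ae ◅◅ joined e f e×f e∈ f∈ ◅◅ Star.reverse (adj-sym graph∩) bf)
    }
    where
    open Intersection I
    joined : ∀ (e f : Edge G) → Crosses e f → Adj graph∩ (lo e) (hi e) → Adj graph∩ (lo f) (hi f) →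
             SameComponent graph∩ (lo e) (lo f)
    joined e f e×f e∈ f∈ with uniqueMinimal⇒least e f (closed e f e×f)
    ... | M , ((_ , conn) , (l∈ , _) , (l′∈ , _)) , low =
      Star.map (λ (u∈ , v∈ , uv) → ∩-glb uv λ {S} S∈F →
        let M⊆S = low (block-contains S e f e×f (∩-lower S∈F e∈) (∩-lower S∈F f∈))
        in induced S (Star.reverse (adj-sym (graph S)) (block⁻ S (M⊆S u∈)) ◅◅ block⁻ S (M⊆S v∈)) uv)
        (conn l∈ l′∈)

  -- `NCBond` for bare matrices, with explicit quantifiers over `Fin n`, so that it is decidable.
  -- Coding matrices as subsets of an n * n element set then lets all bonds be searched.
  IsBond : (Fin n → Fin n → Bool) → Set
  IsBond adj =
    (∀ u v → adj u v ≡ adj v u) × (∀ u → adj u u ≡ false) ×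
    (∀ u v → R u v → Adj G u v) × (∀ u v → Star R u v → Adj G u v → R u v) ×
    (∀ a b c d → a Fin.< b → b Fin.< c → c Fin.< d → Star R a c → Star R b d → Star R a b)
    where
    R : Rel (Fin n) 0ℓ
    R u v = adj u v ≡ true

  isBond? : ∀ adj → Dec (IsBond adj)
  isBond? adj =
    (all? λ u → all? λ v → adj u v ≟ᵇ adj v u) ×-dec (all? λ u → adj u u ≟ᵇ false) ×-dec
    (all? λ u → all? λ v → R? u v →-dec adj? G u v) ×-dec
    (all? λ u → all? λ v → star? R? u v →-dec adj? G u v →-dec R? u v) ×-dec
    (all? λ a → all? λ b → all? λ c → all? λ d → a <? b →-dec b <? c →-dec c <? d →-dec
       star? R? a c →-dec star? R? b d →-dec star? R? a b)
    where
    R? = λ u v → adj u v ≟ᵇ true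

  isBond⇒bond : ∀ {adj} → IsBond adj → NCBond G
  isBond⇒bond {adj} (sy , irr , sub , ind , nc) = record
    { graph       = record { adj = adj ; symm = sy ; irrefl = irr }
    ; subgraph    = sub _ _
    ; induced     = ind _ _
    ; noncrossing = nc _ _ _ _
    }

  -- Stated up to pointwise equality because decoding an encoded matrix returns the original only
  -- pointwise; `F-cong` serves the same purpose for families.
  bond⇒isBond : ∀ (S : NCBond G) {adj′} → (∀ u v → adj′ u v ≡ adj (graph S) u v) → IsBond adj′
  bond⇒isBond S eq =
    (λ u v → trans (eq u v) (trans (Graph.symm (graph S) u v) (sym (eq v u)))) ,
    (λ u → trans (eq u u) (Graph.irrefl (graph S) u)) ,
    (λ u v → subgraph S ∘ to) , (λ u v uv → from ∘ induced S (Star.map to uv)) ,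
    λ a b c d a<b b<c c<d ac bd → Star.map from (noncrossing S a<b b<c c<d (Star.map to ac) (Star.map to bd))
    where
    to : ∀ {u v} → _ ≡ true → Adj (graph S) u v
    to {u} {v} = trans (sym (eq u v))
    from : ∀ {u v} → Adj (graph S) u v → _ ≡ true
    from {u} {v} = trans (eq u v)

  matrix : Subset (n ℕ.* n) → Fin n → Fin n → Bool
  matrix W u v = lookup W (combine u v)

  encode : (Fin n → Fin n → Bool) → Subset (n ℕ.* n)
  encode adj = tabulate (uncurry adj ∘ Fin.remQuot n)

  matrix-encode : ∀ adj u v → matrix (encode adj) u v ≡ adj u v
  matrix-encode adj u v = trans (lookup∘tabulate _ (combine u v)) (cong (uncurry adj) (remQuot-combine u v))

  module _ {F : (Fin n → Fin n → Bool) → Set} (F? : ∀ adj → Dec (F adj))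
           (F-cong : ∀ {f g} → (∀ u v → f u v ≡ g u v) → F f → F g) where

    -- An edge lies in all bonds of the family iff no matrix that codes such a bond omits it, which
    -- a search over subsets decides.
    inAll? : ∀ u v → Dec (Adj G u v × (∀ (S : NCBond G) → F (adj (graph S)) → Adj (graph S) u v))
    inAll? u v = adj? G u v ×-dec map′ sound complete
      (¬? (anySubset? λ W → isBond? (matrix W) ×-dec F? (matrix W) ×-dec ¬? (matrix W u v ≟ᵇ true)))
      where
      Missing : Set
      Missing = ∃ λ W → IsBond (matrix W) × F (matrix W) × ¬ matrix W u v ≡ true
      sound : ¬ Missing → ∀ S → F (adj (graph S)) → Adj (graph S) u v
      sound ¬missing S S∈F = decidable-stable (adj? (graph S) u v) λ uv∉S →
        ¬missing (encode (adj (graph S)) , bond⇒isBond S enc , F-cong (λ x y → sym (enc x y)) S∈F ,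
                  uv∉S ∘ trans (sym (enc u v)))
        where enc = matrix-encode (adj (graph S))
      complete : (∀ S → F (adj (graph S)) → Adj (graph S) u v) → ¬ Missing
      complete all (W , bond , W∈F , uv∉W) = uv∉W (all (isBond⇒bond bond) W∈F)

    intersection : Intersection (λ S → F (adj (graph S)))
    intersection = record
      { graph∩  = decGraph inAll? (λ (uv , all) → adj-sym G uv , λ S S∈F → adj-sym (graph S) (all S S∈F))
                                  (λ (uu , _) → adj-irrefl G uu)
      ; ∩-⊆G    = λ {u} {v} uv → proj₁ (does-sound (inAll? u v) uv)
      ; ∩-lower = λ {S} S∈F {u} {v} uv → proj₂ (does-sound (inAll? u v) uv) S S∈F
      ; ∩-glb   = λ {u} {v} uv all → dec-true (inAll? u v) (uv , λ S S∈F → all {S} S∈F)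
      }

  -- The join is the intersection of all upper bounds. For the meet, `lower` is the family of just H
  -- and K, not that of their lower bounds.
  lower upper : NCBond G → NCBond G → (Fin n → Fin n → Bool) → Set
  upper H K f = ∀ u v → (Adj (graph H) u v → f u v ≡ true) × (Adj (graph K) u v → f u v ≡ true)
  lower H K f = (∀ u v → f u v ≡ adj (graph H) u v) ⊎ (∀ u v → f u v ≡ adj (graph K) u v)

  crossingClosed⇒lattice : CrossingClosed G → IsLatticePoset (NC G)
  crossingClosed⇒lattice closed = _⊔ᴮ_ , _⊓ᴮ_ , record
    { isPartialOrder = Poset.isPartialOrder (NC G)
    ; supremum = λ H K →
        (λ u v uv → Intersection.∩-glb (⊔-int H K) (subgraph H uv) λ {S} S∈F → proj₁ (S∈F u v) uv) ,
        (λ u v uv → Intersection.∩-glb (⊔-int H K) (subgraph K uv) λ {S} S∈F → proj₂ (S∈F u v) uv) ,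
        (λ S H≼S K≼S u v → Intersection.∩-lower (⊔-int H K) {S} λ u v → H≼S u v , K≼S u v)
    ; infimum = λ H K →
        (λ u v → Intersection.∩-lower (⊓-int H K) {H} (inj₁ λ _ _ → refl)) ,
        (λ u v → Intersection.∩-lower (⊓-int H K) {K} (inj₂ λ _ _ → refl)) ,
        (λ S S≼H S≼K u v uv → Intersection.∩-glb (⊓-int H K) (subgraph S uv)
          [ (λ eq → trans (eq u v) (S≼H u v uv)) , (λ eq → trans (eq u v) (S≼K u v uv)) ]′)
    }
    where
    ⊔-int : ∀ H K → Intersection (λ S → upper H K (adj (graph S)))
    ⊔-int H K = intersection {upper H K}
      (λ f → all? λ u → all? λ v → (adj? (graph H) u v →-dec (f u v ≟ᵇ true)) ×-dec
          (adj? (graph K) u v →-dec (f u v ≟ᵇ true)))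
      λ eq up u v → (λ uv → trans (sym (eq u v)) (proj₁ (up u v) uv)) ,
          (λ uv → trans (sym (eq u v)) (proj₂ (up u v) uv))
    ⊓-int : ∀ H K → Intersection (λ S → lower H K (adj (graph S)))
    ⊓-int H K = intersection {lower H K}
      (λ f → (all? λ u → all? λ v → f u v ≟ᵇ adj (graph H) u v) ⊎-dec
          (all? λ u → all? λ v → f u v ≟ᵇ adj (graph K) u v))
      λ eq → [ (λ low → inj₁ λ u v → trans (sym (eq u v)) (low u v)) ,
          (λ low → inj₂ λ u v → trans (sym (eq u v)) (low u v)) ]′
    _⊔ᴮ_ _⊓ᴮ_ : NCBond G → NCBond G → NCBond G
    H ⊔ᴮ K = ⋂ closed (⊔-int H K)
    H ⊓ᴮ K = ⋂ closed (⊓-int H K)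

  -- All blocks outside U are singletons. A walk between distinct vertices starts in U, so in a
  -- crossing pattern both a and b lie in U, which is connected.
  blockBond : ∀ {U} → ConnectedOn G U → NCBond G
  blockBond {U} (_ , conn) = record
    { graph       = decGraph (adjIn? G U) (adjIn-sym G) (λ (_ , _ , uu) → adj-irrefl G uu)
    ; subgraph    = AdjIn⊆Adj G ∘ sound
    ; induced     = λ {u} {v} uv adj → dec-true (adjIn? G U u v) (inU uv adj)
    ; noncrossing = λ {a} {b} a<b b<c c<d ac bd →
        Star.map (dec-true (adjIn? G U _ _)) (conn
          (start (λ { refl → ℕₚ.<-irrefl refl (ℕₚ.<-trans a<b b<c) }) ac)
          (start (λ { refl → ℕₚ.<-irrefl refl (ℕₚ.<-trans b<c c<d) }) bd))
    }
    where
    sound : ∀ {u v} → does (adjIn? G U u v) ≡ true → AdjIn G U u v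
    sound {u} {v} = does-sound (adjIn? G U u v)
    start : ∀ {u v} → u ≢ v → Star (λ u v → does (adjIn? G U u v) ≡ true) u v → u ∈ U
    start u≢v ε       = contradiction refl u≢v
    start {u} u≢v (_◅_ {j = w} r _) = proj₁ (sound {u} {w} r)
    inU : ∀ {u v} → Star (λ u v → does (adjIn? G U u v) ≡ true) u v → Adj G u v → AdjIn G U u v
    inU {u} {v} ε       adj = contradiction adj (adj-irrefl G)
    inU {u} {v} (_◅_ {j = w} r s) adj =
      let u∈ , w∈ , _ = sound {u} {w} r in u∈ , Star-∈ G (Star.map (λ {x} {y} → sound {x} {y}) s) w∈ , adj

  lattice⇒crossingClosed : IsLatticePoset (NC G) → CrossingClosed G
  lattice⇒crossingClosed (_⊔ᴮ_ , _ , isLattice) e f e×f = least⇒uniqueMinimal e f (block J (lo e) ,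
    block-contains J e f e×f (proj₁ sup _ _ (self e)) (proj₁ (proj₂ sup) _ _ (self f)) , low)
    where
    B : Edge G → NCBond G
    B e = blockBond (proj₁ (proj₂ (edge-connected e)))
    J = B e ⊔ᴮ B f
    sup = IsLattice.supremum isLattice (B e) (B f)
    self : ∀ e → Adj (graph (B e)) (lo e) (hi e)
    self e = let U , _ , (l∈ , h∈) , _ = edge-connected e
             in dec-true (adjIn? G U (lo e) (hi e)) (l∈ , h∈ , Edge.adjacent e)
    B≼ : ∀ {V} (conn : ConnectedOn G V) e → e ⊑ V → B e ≼ blockBond conn
    B≼ {V} conn e e⊑ u v uv =
      let U , _ , _ , only = edge-connected e
          u∈ , v∈ , uv′ = does-sound (adjIn? G U u v) uv
      in dec-true (adjIn? G V u v) (∈ᵉ-⊑ {e = e} (only u∈) e⊑ , ∈ᵉ-⊑ {e = e} (only v∈) e⊑ , uv′)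
    -- The bond with V as its block is above both one-edge bonds, hence above J; walks in J from
    -- `lo e` therefore stay in V.
    low : ∀ {V} → ConnectedContaining G e f V → block J (lo e) ⊆ V
    low {V} (conn , e⊑ , f⊑) v∈ =
      Star-∈ G (Star.map (λ {u} {v} uv → does-sound (adjIn? G V u v)
                 (proj₂ (proj₂ sup) (blockBond conn) (B≼ conn e e⊑) (B≼ conn f f⊑) u v uv)) (block⁻ J v∈))
               (proj₁ e⊑)

-- Hoare-style rules and cost bounds for the machine

≡ᵇ-true : ∀ {a b} → (a ≡ᵇ b) ≡ true → a ≡ b
≡ᵇ-true {a} {b} = ℕₚ.≡ᵇ⇒≡ a b ∘ Equivalence.from T-≡

≡ᵇ-false : ∀ {a b} → (a ≡ᵇ b) ≡ false → a ≢ b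
≡ᵇ-false {a} {b} ≡false a≡b with trans (sym ≡false) (Equivalence.to T-≡ (ℕₚ.≡⇒≡ᵇ a b a≡b))
... | ()

≢⇒≡ᵇ-false : ∀ {a b} → a ≢ b → (a ≡ᵇ b) ≡ false
≢⇒≡ᵇ-false a≢b = ¬-not (a≢b ∘ ≡ᵇ-true)

≡ᵇ-refl : ∀ a → (a ≡ᵇ a) ≡ true
≡ᵇ-refl a = Equivalence.to T-≡ (ℕₚ.≡⇒≡ᵇ a a refl)

<ᵇ-true : ∀ {a b} → (a <ᵇ b) ≡ true → a < b
<ᵇ-true {a} {b} = ℕₚ.<ᵇ⇒< a b ∘ Equivalence.from T-≡

<⇒<ᵇ-true : ∀ {a b} → a < b → (a <ᵇ b) ≡ true
<⇒<ᵇ-true = Equivalence.to T-≡ ∘ ℕₚ.<⇒<ᵇ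

<ᵇ-false : ∀ {a b} → (a <ᵇ b) ≡ false → b ≤ a
<ᵇ-false {a} {b} ≡false = ℕₚ.≮⇒≥ λ a<b → contradiction (trans (sym ≡false) (<⇒<ᵇ-true a<b)) λ ()

∧-true : ∀ {a b} → a ∧ b ≡ true → a ≡ true × b ≡ true
∧-true {true} b≡ = refl , b≡

∨-false : ∀ {a b} → a ∨ b ≡ false → a ≡ false × b ≡ false
∨-false {false} b≡ = refl , b≡

not-true : ∀ {a} → not a ≡ true → a ≡ false
not-true {false} _ = refl

setCell-same : ∀ A i x σ → arrays (setCell A i x σ) A i ≡ x
setCell-same A i x σ rewrite ≡ᵇ-refl A | ≡ᵇ-refl i = refl

setCell-index : ∀ A {i} x σ B {j} → j ≢ i → arrays (setCell A i x σ) B j ≡ arrays σ B j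
setCell-index A x σ B j≢i rewrite ≢⇒≡ᵇ-false j≢i with B ≡ᵇ A
... | true  = refl
... | false = refl

setCell-array : ∀ {A} i x σ {B} j → B ≢ A → arrays (setCell A i x σ) B j ≡ arrays σ B j
setCell-array i x σ j B≢A rewrite ≢⇒≡ᵇ-false B≢A = refl

-- Syntactic analyses of programs

-- An overapproximation computed from the syntax, so that frame conditions for concrete statements
-- hold by `refl`.
writesReg : Stmt → Register → Bool
writesReg skip                  s = false
writesReg (r ≔ _)               s = s ≡ᵇ r
writesReg (_ ⟦ _ ⟧≔ _)          s = false
writesReg (S ⍮ S′)              s = writesReg S s ∨ writesReg S′ s
writesReg (If _ Then S Else S′) s = writesReg S s ∨ writesReg S′ s
writesReg (For r Below _ Do S)  s = (s ≡ᵇ r) ∨ writesReg S s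

writesArray : Stmt → Array → Bool
writesArray skip                  B = false
writesArray (_ ≔ _)               B = false
writesArray (A ⟦ _ ⟧≔ _)          B = B ≡ᵇ A
writesArray (S ⍮ S′)              B = writesArray S B ∨ writesArray S′ B
writesArray (If _ Then S Else S′) B = writesArray S B ∨ writesArray S′ B
writesArray (For _ Below _ Do S)  B = writesArray S B

-- Meant for `answer`: the pair checks assign it nothing but 0, so a negative verdict persists.
keepsZero : Stmt → Register → Bool
keepsZero skip                  s = true
keepsZero (r ≔ lit zero)        s = true
keepsZero (r ≔ _)               s = not (s ≡ᵇ r)
keepsZero (_ ⟦ _ ⟧≔ _)          s = true
keepsZero (S ⍮ S′)              s = keepsZero S s ∧ keepsZero S′ s
keepsZero (If _ Then S Else S′) s = keepsZero S s ∧ keepsZero S′ s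
keepsZero (For r Below _ Do S)  s = not (s ≡ᵇ r) ∧ keepsZero S s

sizeLoops : Stmt → Bool
sizeLoops (S ⍮ S′)                 = sizeLoops S ∧ sizeLoops S′
sizeLoops (If _ Then S Else S′)    = sizeLoops S ∧ sizeLoops S′
sizeLoops (For _ Below size Do S)  = sizeLoops S
sizeLoops (For _ Below _ Do _)     = false
sizeLoops _                        = true

loopDepth : Stmt → ℕ
loopDepth (S ⍮ S′)              = loopDepth S ⊔ loopDepth S′
loopDepth (If _ Then S Else S′) = loopDepth S ⊔ loopDepth S′
loopDepth (For _ Below _ Do S)  = suc (loopDepth S)
loopDepth _                     = 0

iterate-invariant : (P : ℕ → State → Set) (f : ℕ → State → State) → ∀ k {σ} → P 0 σ →
                    (∀ j τ → j < k → P j τ → P (suc j) (f j τ)) → P k (iterate f k σ)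
iterate-invariant P f zero    p step = p
iterate-invariant P f (suc k) p step =
  step k _ ℕₚ.≤-refl (iterate-invariant P f k p λ j τ j<k → step j τ (ℕₚ.m≤n⇒m≤1+n j<k))

sumBelow-≤ : ∀ f c k → (∀ j → f j ≤ c) → sumBelow f k ≤ k * c
sumBelow-≤ f c zero    f≤c = z≤n
sumBelow-≤ f c (suc k) f≤c = ℕₚ.≤-trans (ℕₚ.+-mono-≤ (sumBelow-≤ f c k f≤c) (f≤c k))
    (ℕₚ.≤-reflexive (ℕₚ.+-comm (k * c) c))

module Rules {n : ℕ} (G : Graph n) where

  open Machine G

  if-rule : (P : State → Set) → ∀ Test S S′ {σ} → (⟦ Test ⟧ᵗ σ ≡ true → P (run S σ)) →
            (⟦ Test ⟧ᵗ σ ≡ false → P (run S′ σ)) → P (run (If Test Then S Else S′) σ)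
  if-rule P Test S S′ {σ} p p′ with ⟦ Test ⟧ᵗ σ
  ... | true  = p refl
  ... | false = p′ refl

  frame-reg : ∀ S {s} σ → writesReg S s ≡ false → regs (run S σ) s ≡ regs σ s
  frame-reg skip                    σ w = refl
  frame-reg (r ≔ E)                 σ w rewrite w = refl
  frame-reg (A ⟦ E ⟧≔ F)            σ w = refl
  frame-reg (S ⍮ S′)                σ w = let w₁ , w₂ = ∨-false w in
    trans (frame-reg S′ (run S σ) w₂) (frame-reg S σ w₁)
  frame-reg (If Test Then S Else S′) {s} σ w = let w₁ , w₂ = ∨-false w in
    if-rule (λ τ → regs τ s ≡ regs σ s) Test S S′ (λ _ → frame-reg S σ w₁) (λ _ → frame-reg S′ σ w₂)
  frame-reg (For r Below E Do S) {s} σ w = let w₁ , w₂ = ∨-false w in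
    iterate-invariant (λ _ τ → regs τ s ≡ regs σ s) _ (⟦ E ⟧ᵉ σ) refl λ j τ _ eq →
      trans (frame-reg S (setReg r j τ) w₂) (trans (cong (λ b → if b then j else regs τ s) w₁) eq)

  frame-array : ∀ S {B} i σ → writesArray S B ≡ false → arrays (run S σ) B i ≡ arrays σ B i
  frame-array skip                    i σ w = refl
  frame-array (r ≔ E)                 i σ w = refl
  frame-array (A ⟦ E ⟧≔ F)            i σ w rewrite w = refl
  frame-array (S ⍮ S′)                i σ w = let w₁ , w₂ = ∨-false w in
    trans (frame-array S′ i (run S σ) w₂) (frame-array S i σ w₁)
  frame-array (If Test Then S Else S′) {B} i σ w = let w₁ , w₂ = ∨-false w in
    if-rule (λ τ → arrays τ B i ≡ arrays σ B i) Test S S′ (λ _ → frame-array S i σ w₁)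
        (λ _ → frame-array S′ i σ w₂)
  frame-array (For r Below E Do S) {B} i σ w =
    iterate-invariant (λ _ τ → arrays τ B i ≡ arrays σ B i) _ (⟦ E ⟧ᵉ σ) refl λ j τ _ eq →
      trans (frame-array S i (setReg r j τ) w) eq

  private
    unset : ∀ {s r x σ} → not (s ≡ᵇ r) ≡ true → regs σ s ≡ 0 → regs (setReg r x σ) s ≡ 0
    unset w z rewrite not-true w = z

  zero-kept : ∀ S {s} σ → keepsZero S s ≡ true → regs σ s ≡ 0 → regs (run S σ) s ≡ 0
  zero-kept skip                 σ k z = z
  zero-kept (r ≔ lit zero) {s}   σ k z with s ≡ᵇ r
  ... | true  = refl
  ... | false = z
  zero-kept (r ≔ lit (suc _))    σ k z = unset {σ = σ} k z
  zero-kept (r ≔ size)           σ k z = unset {σ = σ} k z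
  zero-kept (r ≔ reg _)          σ k z = unset {σ = σ} k z
  zero-kept (r ≔ (_ ⟦ _ ⟧))      σ k z = unset {σ = σ} k z
  zero-kept (r ≔ inc _)          σ k z = unset {σ = σ} k z
  zero-kept (A ⟦ E ⟧≔ F)         σ k z = z
  zero-kept (S ⍮ S′)             σ k z = let k₁ , k₂ = ∧-true k in
    zero-kept S′ (run S σ) k₂ (zero-kept S σ k₁ z)
  zero-kept (If Test Then S Else S′) {s} σ k z = let k₁ , k₂ = ∧-true k in
    if-rule (λ τ → regs τ s ≡ 0) Test S S′ (λ _ → zero-kept S σ k₁ z) (λ _ → zero-kept S′ σ k₂ z)
  zero-kept (For r Below E Do S) {s} σ k z = let k₁ , k₂ = ∧-true k in
    iterate-invariant (λ _ τ → regs τ s ≡ 0) _ (⟦ E ⟧ᵉ σ) z λ j τ _ z →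
        zero-kept S (setReg r j τ) k₂ (unset {σ = τ} k₁ z)

  -- The coefficient of the bound below, not a running time: both branches of a conditional are
  -- added, and a loop is charged one unit per round besides its body.
  weight : Stmt → ℕ
  weight skip                  = 1
  weight (_ ≔ E)               = suc (costᵉ E)
  weight (_ ⟦ E ⟧≔ F)          = suc (costᵉ E + costᵉ F)
  weight (S ⍮ S′)              = weight S + weight S′
  weight (If T Then S Else S′) = suc (costᵗ T) + (weight S + weight S′)
  weight (For _ Below E Do S)  = suc (costᵉ E) + suc (weight S)

  -- Lower powers of n are absorbed into the highest one, which needs n nonzero; for n = 0 the right
  -- side vanishes as soon as there is a loop.
  time-bound : .{{_ : NonZero n}} → ∀ S σ → sizeLoops S ≡ true → time S σ ≤ weight S * n ^ loopDepth S
  time-bound = go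
    where
    open ℕₚ.≤-Reasoning
    module _ (d : ℕ) where
      pow≥1 : 1 ≤ n ^ d
      pow≥1 = ℕₚ.m^n>0 n d
      scale : ∀ c → c ≤ c * n ^ d
      scale c = ℕₚ.≤-trans (ℕₚ.≤-reflexive (sym (ℕₚ.*-identityʳ c))) (ℕₚ.*-monoʳ-≤ c pow≥1)
    grow : ∀ {d d′} c → d ≤ d′ → c * n ^ d ≤ c * n ^ d′
    grow c d≤d′ = ℕₚ.*-monoʳ-≤ c (ℕₚ.^-monoʳ-≤ n d≤d′)
    go : ∀ S σ → sizeLoops S ≡ true → time S σ ≤ weight S * n ^ loopDepth S
    go skip         σ _ = scale 0 _
    go (_ ≔ _)      σ _ = scale 0 _
    go (_ ⟦ _ ⟧≔ _) σ _ = scale 0 _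
    go (S ⍮ S′) σ l = let l₁ , l₂ = ∧-true l ; d = loopDepth S ; d′ = loopDepth S′ in begin
      time S σ + time S′ (run S σ)                          ≤⟨ ℕₚ.+-mono-≤ (go S σ l₁) (go S′ _ l₂) ⟩
      weight S * n ^ d + weight S′ * n ^ d′                 ≤⟨ ℕₚ.+-mono-≤
          (grow (weight S) (ℕₚ.m≤m⊔n d d′)) (grow (weight S′) (ℕₚ.m≤n⊔m d d′)) ⟩
      weight S * n ^ (d ⊔ d′) + weight S′ * n ^ (d ⊔ d′)    ≡⟨ ℕₚ.*-distribʳ-+
          (n ^ (d ⊔ d′)) (weight S) (weight S′) ⟨
      (weight S + weight S′) * n ^ (d ⊔ d′)                 ∎
    go (If Test Then S Else S′) σ l = let l₁ , l₂ = ∧-true l ; d = loopDepth S ; d′ =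
                                            loopDepth S′ ; c = suc (costᵗ Test) in begin
      c + (if ⟦ Test ⟧ᵗ σ then time S σ else time S′ σ)
        ≤⟨ ℕₚ.+-mono-≤ (scale (d ⊔ d′) c) (branch (⟦ Test ⟧ᵗ σ)
             (ℕₚ.≤-trans (go S σ l₁) (grow (weight S) (ℕₚ.m≤m⊔n d d′)))
             (ℕₚ.≤-trans (go S′ σ l₂) (grow (weight S′) (ℕₚ.m≤n⊔m d d′)))) ⟩
      c * n ^ (d ⊔ d′) + (weight S * n ^ (d ⊔ d′) + weight S′ * n ^ (d ⊔ d′))
        ≡⟨ cong (c * n ^ (d ⊔ d′) +_) (ℕₚ.*-distribʳ-+ (n ^ (d ⊔ d′)) (weight S) (weight S′)) ⟨
      c * n ^ (d ⊔ d′) + (weight S + weight S′) * n ^ (d ⊔ d′)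
        ≡⟨ ℕₚ.*-distribʳ-+ (n ^ (d ⊔ d′)) c (weight S + weight S′) ⟨
      (c + (weight S + weight S′)) * n ^ (d ⊔ d′) ∎
      where
      branch : ∀ b {t t′ u u′} → t ≤ u → t′ ≤ u′ → (if b then t else t′) ≤ u + u′
      branch true  t≤ _  = ℕₚ.≤-trans t≤ (ℕₚ.m≤m+n _ _)
      branch false _ t′≤ = ℕₚ.≤-trans t′≤ (ℕₚ.m≤n+m _ _)
    go (For r Below size Do S) σ l = let d = loopDepth S ; w = suc (weight S) in begin
      2 + sumBelow _ n
        ≤⟨ ℕₚ.+-mono-≤ (scale (suc d) 2) (sumBelow-≤ _ (suc (weight S) * n ^ d) n λ j →
             ℕₚ.+-mono-≤ (pow≥1 d) (go S _ l)) ⟩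
      2 * n ^ suc d + n * (suc (weight S) * n ^ d)
        ≡⟨ cong (2 * n ^ suc d +_)
            (trans (sym (ℕₚ.*-assoc n w (n ^ d)))
            (trans (cong (_* n ^ d) (ℕₚ.*-comm n w)) (ℕₚ.*-assoc w n (n ^ d)))) ⟩
      2 * n ^ suc d + suc (weight S) * n ^ suc d
        ≡⟨ ℕₚ.*-distribʳ-+ (n ^ suc d) 2 (suc (weight S)) ⟨
      (2 + suc (weight S)) * n ^ suc d ∎

-- Breadth-first search

module Bfs (n : ℕ) (E : ℕ → ℕ → Set) (s₁ s₂ : ℕ) where

  -- The state of the search when the first h of the t vertices queued so far have been
  -- processed: q is the queue, l the levels and p the predecessors.
  record Inv (h t : ℕ) (q l p : ℕ → ℕ) : Set where
    field
      source₁  : l s₁ ≡ 1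
      source₂  : l s₂ ≡ 1
      queued   : ∀ {k} → k < t → q k < n × 1 ≤ l (q k)
      position : ∀ {v} → v < n → 1 ≤ l v → ∃ λ k → k < t × q k ≡ v
      distinct : ∀ {k k′} → k < t → k′ < t → q k ≡ q k′ → k ≡ k′
      monotone : ∀ {k k′} → k ≤ k′ → k′ < t → l (q k) ≤ l (q k′)
      -- The queue spans at most two levels from the head on: no queued vertex is more than one
      -- level above a pending one.
      near     : ∀ {k k′} → h ≤ k → k < t → k′ < t → l (q k′) ≤ suc (l (q k))
      -- Bounds all levels by n in the end, so that n rounds suffice to follow a path back to e.
      small    : ∀ {k} → k < t → l (q k) ≤ suc k
      parent   : ∀ {v m} → v < n → l v ≡ suc (suc m) → p v < n × E (p v) v × l (p v) ≡ suc m
      level₁   : ∀ {v} → v < n → l v ≡ 1 → v ≡ s₁ ⊎ v ≡ s₂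
      -- The bound k < t is separate because h runs up to n even when the queue is exhausted
      -- earlier.
      done     : ∀ {k w} → k < h → k < t → E (q k) w → 1 ≤ l w × l w ≤ suc (l (q k))

  open Inv

  start : ∀ {q l p} → s₁ < n → s₂ < n → s₁ ≢ s₂ → q 0 ≡ s₁ → q 1 ≡ s₂ → l s₁ ≡ 1 → l s₂ ≡ 1 →
          (∀ {v} → v < n → v ≢ s₁ → v ≢ s₂ → l v ≡ 0) → Inv 0 2 q l p
  start {q} {l} {p} s₁<n s₂<n s₁≢s₂ refl refl l₁ l₂ l₀ = record
    { source₁ = l₁ ; source₂ = l₂
    ; queued   = λ { {0} _ → s₁<n , ℕₚ.≤-reflexive (sym l₁) ; {1} _ → s₂<n , ℕₚ.≤-reflexive (sym l₂)
                   ; {suc (suc _)} (s≤s (s≤s ())) }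
    ; position = pos
    ; distinct = λ { {0} {0} _ _ _ → refl ; {0} {1} _ _ eq → contradiction eq s₁≢s₂
                   ; {1} {0} _ _ eq → contradiction (sym eq) s₁≢s₂ ; {1} {1} _ _ _ → refl
                   ; {suc (suc _)} (s≤s (s≤s ())) ; {0} {suc (suc _)} _ (s≤s (s≤s ()))
                       ; {1} {suc (suc _)} _ (s≤s (s≤s ())) }
    ; monotone = λ k≤k′ k′<2 → ℕₚ.≤-reflexive (trans (one (ℕₚ.≤-<-trans k≤k′ k′<2)) (sym (one k′<2)))
    ; near     = λ _ k<2 k′<2 → ℕₚ.≤-trans (ℕₚ.≤-reflexive (trans (one k′<2) (sym (one k<2)))) (ℕₚ.n≤1+n _)
    ; small    = λ k<2 → ℕₚ.≤-trans (ℕₚ.≤-reflexive (one k<2)) (s≤s z≤n)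
    ; parent   = par
    ; level₁   = lev
    ; done     = λ ()
    }
    where
    one : ∀ {k} → k < 2 → l (q k) ≡ 1
    one {0} _ = l₁
    one {1} _ = l₂
    one {suc (suc _)} (s≤s (s≤s ()))
    lev : ∀ {v m} → v < n → l v ≡ suc m → v ≡ q 0 ⊎ v ≡ q 1
    lev {v} v<n lv with v ℕₚ.≟ q 0 | v ℕₚ.≟ q 1
    ... | yes v≡ | _      = inj₁ v≡
    ... | no _   | yes v≡ = inj₂ v≡
    ... | no v≢₁ | no v≢₂ = contradiction (trans (sym lv) (l₀ v<n v≢₁ v≢₂)) λ ()
    pos : ∀ {v} → v < n → 1 ≤ l v → ∃ λ k → k < 2 × q k ≡ v
    pos {v} v<n 1≤ with l v in lv
    pos v<n (s≤s _) | suc m with lev v<n lv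
    ... | inj₁ refl = 0 , s≤s z≤n , refl
    ... | inj₂ refl = 1 , s≤s (s≤s z≤n) , refl
    par : ∀ {v m} → v < n → l v ≡ suc (suc m) → p v < n × E (p v) v × l (p v) ≡ suc m
    par v<n lv with lev v<n lv
    ... | inj₁ refl = contradiction (trans (sym lv) l₁) λ ()
    ... | inj₂ refl = contradiction (trans (sym lv) l₂) λ ()

  Seen : (l : ℕ → ℕ) (u w : ℕ) → Set
  Seen l u w = 1 ≤ l w × l w ≤ suc (l u)

  seen : ∀ {h t q l p} → Inv h t q l p → h < t → ∀ {w} → w < n → 1 ≤ l w → Seen l (q h) w
  seen inv h<t w<n 1≤ with position inv w<n 1≤
  ... | k , k<t , refl = 1≤ , near inv ℕₚ.≤-refl h<t k<t

  process : ∀ {h t q l p} → Inv h t q l p → (h < t → ∀ {w} → E (q h) w → Seen l (q h) w) → Inv (suc h) t q l p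
  process {h} {t} {q} {l} inv all = record
    { source₁ = source₁ inv ; source₂ = source₂ inv ; queued = queued inv ; position = position inv
    ; distinct = distinct inv ; monotone = monotone inv ; near = λ h<k → near inv (ℕₚ.<⇒≤ h<k)
    ; small = small inv ; parent = parent inv ; level₁ = level₁ inv ; done = done′
    }
    where
    done′ : ∀ {k w} → k < suc h → k < t → E (q k) w → Seen l (q k) w
    done′ k<1+h k<t with ℕₚ.m<1+n⇒m<n∨m≡n k<1+h
    ... | inj₁ k<h  = done inv k<h k<t
    ... | inj₂ refl = all k<t

  -- The vertex c was unlabelled, so facts about labelled vertices persist. By `near` its level is
  -- at least every queued one, which keeps the queue sorted; by `monotone` it is at most one above
  -- every pending one.
  push : ∀ {h t q l p q′ l′ p′ c} → Inv h t q l p → h < t → c < n → E (q h) c → l c ≡ 0 →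
         q′ t ≡ c → (∀ {k} → k ≢ t → q′ k ≡ q k) →
         l′ c ≡ suc (l (q h)) → (∀ {v} → v ≢ c → l′ v ≡ l v) →
         p′ c ≡ q h → (∀ {v} → v ≢ c → p′ v ≡ p v) →
         Inv h (suc t) q′ l′ p′ × (∀ {w} → Seen l (q h) w → Seen l′ (q h) w)
  push {h} {t} {q} {l} {p} {q′} {l′} {p′} {c} inv h<t c<n E-c lc≡0 q-t q-≢ l-c l-≢ p-c p-≢ = record
    { source₁  = trans (l-≢ (old (ℕₚ.≤-reflexive (sym (source₁ inv))))) (source₁ inv)
    ; source₂  = trans (l-≢ (old (ℕₚ.≤-reflexive (sym (source₂ inv))))) (source₂ inv)
    ; queued   = queued′
    ; position = position′
    ; distinct = distinct′
    ; monotone = monotone′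
    ; near     = near′
    ; small    = small′
    ; parent   = parent′
    ; level₁   = level₁′
    ; done     = λ {k} k<h _ Ekw → let k<t = ℕₚ.<-trans k<h h<t in
                   subst (λ u → Seen l′ u _) (sym (q-old k<t))
                       (keep k<t (done inv k<h k<t (subst (λ u → E u _) (q-old k<t) Ekw)))
    } , keep h<t
    where
    old : ∀ {v} → 1 ≤ l v → v ≢ c
    old 1≤ refl = contradiction (subst (1 ≤_) lc≡0 1≤) λ ()
    q-old : ∀ {k} → k < t → q′ k ≡ q k
    q-old k<t = q-≢ (ℕₚ.<⇒≢ k<t)
    l-old : ∀ {k} → k < t → l′ (q k) ≡ l (q k)
    l-old k<t = l-≢ (old (proj₂ (queued inv k<t)))
    lq-old : ∀ {k} → k < t → l′ (q′ k) ≡ l (q k)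
    lq-old k<t = trans (cong l′ (q-old k<t)) (l-old k<t)
    lq-t : l′ (q′ t) ≡ suc (l (q h))
    lq-t = trans (cong l′ q-t) l-c
    cases : ∀ {k} → k < suc t → k < t ⊎ k ≡ t
    cases = ℕₚ.m<1+n⇒m<n∨m≡n
    keep : ∀ {k w} → k < t → Seen l (q k) w → Seen l′ (q k) w
    keep k<t (1≤ , ≤l) = subst₂ (λ a b → 1 ≤ b × b ≤ suc a) (sym (l-old k<t)) (sym (l-≢ (old 1≤))) (1≤ , ≤l)
    queued′ : ∀ {k} → k < suc t → q′ k < n × 1 ≤ l′ (q′ k)
    queued′ k< with cases k<
    ... | inj₁ k<t  = subst (_< n) (sym (q-old k<t)) (proj₁ (queued inv k<t)) ,
        subst (1 ≤_) (sym (lq-old k<t)) (proj₂ (queued inv k<t))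
    ... | inj₂ refl = subst (_< n) (sym q-t) c<n , subst (1 ≤_) (sym lq-t) (s≤s z≤n)
    position′ : ∀ {v} → v < n → 1 ≤ l′ v → ∃ λ k → k < suc t × q′ k ≡ v
    position′ {v} v<n 1≤ with v ℕₚ.≟ c
    ... | yes refl = t , ℕₚ.≤-refl , q-t
    ... | no v≢c   = let k , k<t , eq = position inv v<n (subst (1 ≤_) (l-≢ v≢c) 1≤)
                     in k , ℕₚ.m<n⇒m<1+n k<t , trans (q-old k<t) eq
    q≢c : ∀ {k} → k < t → q k ≢ c
    q≢c k<t = old (proj₂ (queued inv k<t))
    distinct′ : ∀ {k k′} → k < suc t → k′ < suc t → q′ k ≡ q′ k′ → k ≡ k′
    distinct′ k< k′< eq with cases k< | cases k′<
    ... | inj₁ k<t  | inj₁ k′<t = distinct inv k<t k′<t (trans (sym (q-old k<t)) (trans eq (q-old k′<t)))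
    ... | inj₁ k<t  | inj₂ refl = contradiction (trans (sym (q-old k<t)) (trans eq q-t)) (q≢c k<t)
    ... | inj₂ refl | inj₁ k′<t = contradiction (trans (sym (q-old k′<t)) (trans (sym eq) q-t)) (q≢c k′<t)
    ... | inj₂ refl | inj₂ refl = refl
    monotone′ : ∀ {k k′} → k ≤ k′ → k′ < suc t → l′ (q′ k) ≤ l′ (q′ k′)
    monotone′ {k} k≤k′ k′< with cases k′<
    ... | inj₁ k′<t = subst₂ _≤_ (sym (lq-old (ℕₚ.≤-<-trans k≤k′ k′<t))) (sym (lq-old k′<t))
        (monotone inv k≤k′ k′<t)
    ... | inj₂ refl with ℕₚ.m≤n⇒m<n∨m≡n k≤k′
    ...   | inj₁ k<t  = subst₂ _≤_ (sym (lq-old k<t)) (sym lq-t) (near inv ℕₚ.≤-refl h<t k<t)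
    ...   | inj₂ refl = ℕₚ.≤-refl
    near′ : ∀ {k k′} → h ≤ k → k < suc t → k′ < suc t → l′ (q′ k′) ≤ suc (l′ (q′ k))
    near′ h≤k k< k′< with cases k< | cases k′<
    ... | inj₁ k<t  | inj₁ k′<t =
        subst₂ _≤_ (sym (lq-old k′<t)) (sym (cong suc (lq-old k<t))) (near inv h≤k k<t k′<t)
    ... | inj₁ k<t  | inj₂ refl = subst₂ _≤_ (sym lq-t) (sym (cong suc (lq-old k<t)))
        (s≤s (monotone inv h≤k k<t))
    ... | inj₂ refl | inj₁ k′<t = subst₂ _≤_ (sym (lq-old k′<t)) (sym (cong suc lq-t))
        (ℕₚ.m≤n⇒m≤1+n (near inv ℕₚ.≤-refl h<t k′<t))
    ... | inj₂ refl | inj₂ refl = ℕₚ.n≤1+n _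
    small′ : ∀ {k} → k < suc t → l′ (q′ k) ≤ suc k
    small′ k< with cases k<
    ... | inj₁ k<t  = subst (_≤ _) (sym (lq-old k<t)) (small inv k<t)
    ... | inj₂ refl = subst (_≤ _) (sym lq-t) (s≤s (ℕₚ.≤-trans (small inv h<t) h<t))
    parent′ : ∀ {v m} → v < n → l′ v ≡ suc (suc m) → p′ v < n × E (p′ v) v × l′ (p′ v) ≡ suc m
    parent′ {v} v<n eq with v ℕₚ.≟ c
    ... | yes refl = subst (λ u → u < n × E u c × l′ u ≡ _) (sym p-c)
                       (proj₁ (queued inv h<t) , E-c ,
                           trans (l-old h<t) (ℕₚ.suc-injective (trans (sym l-c) eq)))
    ... | no v≢c   = let p<n , Epv , lp = parent inv v<n (trans (sym (l-≢ v≢c)) eq)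
                     in subst (λ u → u < n × E u v × l′ u ≡ _) (sym (p-≢ v≢c))
                          (p<n , Epv , trans (l-≢ (old (subst (1 ≤_) (sym lp) (s≤s z≤n)))) lp)
    level₁′ : ∀ {v} → v < n → l′ v ≡ 1 → v ≡ s₁ ⊎ v ≡ s₂
    level₁′ {v} v<n eq with v ℕₚ.≟ c
    ... | yes refl = contradiction
        (subst (1 ≤_) (ℕₚ.suc-injective (trans (sym l-c) eq)) (proj₂ (queued inv h<t))) λ ()
    ... | no v≢c   = level₁ inv v<n (trans (sym (l-≢ v≢c)) eq)

  -- The queue lists distinct vertices; hence n rounds of the head loop process all of it.
  length≤n : ∀ {h t q l p} → Inv h t q l p → t ≤ n
  length≤n {t = t} {q} inv = injective⇒≤ {f = λ k → fromℕ< (proj₁ (queued inv (toℕ<n k)))} λ {k} {k′} eq →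
    toℕ-injective (distinct inv (toℕ<n k) (toℕ<n k′)
      (trans (sym (toℕ-fromℕ< _)) (trans (cong toℕ eq) (toℕ-fromℕ< _))))

  -- All that is needed of a finished search: `parent` yields a walk back to a source and `step`
  -- bounds levels along any walk, so together they make levels exact distances plus one.
  record Levels (l p : ℕ → ℕ) : Set where
    field
      source₁ : l s₁ ≡ 1
      source₂ : l s₂ ≡ 1
      level₁  : ∀ {v} → v < n → l v ≡ 1 → v ≡ s₁ ⊎ v ≡ s₂
      level≤n : ∀ {v} → v < n → l v ≤ n
      parent  : ∀ {v m} → v < n → l v ≡ suc (suc m) → p v < n × E (p v) v × l (p v) ≡ suc m
      step    : ∀ {v w} → v < n → 1 ≤ l v → E v w → 1 ≤ l w × l w ≤ suc (l v)

  finish : ∀ {t q l p} → Inv n t q l p → Levels l p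
  finish {t} {q} {l} inv = record
    { source₁ = source₁ inv ; source₂ = source₂ inv ; level₁ = level₁ inv ; level≤n = level≤n
    ; parent = parent inv ; step = step }
    where
    level≤n : ∀ {v} → v < n → l v ≤ n
    level≤n {v} v<n with l v in lv
    ... | zero  = z≤n
    ... | suc _ with position inv v<n (subst (1 ≤_) (sym lv) (s≤s z≤n))
    ...   | k , k<t , refl = subst (_≤ n) lv (ℕₚ.≤-trans (small inv k<t) (ℕₚ.≤-trans k<t (length≤n inv)))
    step : ∀ {v w} → v < n → 1 ≤ l v → E v w → Seen l v w
    step v<n 1≤ with position inv v<n 1≤
    ... | k , k<t , refl = done inv (ℕₚ.<-≤-trans k<t (length≤n inv)) k<t

-- Verification of the search program

module SearchCorrect {n : ℕ} (G : Graph n) {lev par : Array} (lev≢queue : lev ≢ Program.queue)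
                     (par≢queue : par ≢ Program.queue) (par≢lev : par ≢ lev) where

  open Machine G
  open Rules G
  open Program hiding (v; u; i; y)

  module _ {x s₁ s₂ : ℕ} where

    -- Only the target is compared with x, as in the program. Here x is a number, so the value n
    -- stands for removing nothing.
    E : ℕ → ℕ → Set
    E v w = entry v w ≡ true × w ≢ x

    open Bfs n E s₁ s₂

    entry-bound : ∀ {v w} → entry v w ≡ true → w < n
    entry-bound {v} {w} eq with v ℕₚ.<? n | w ℕₚ.<? n
    ... | yes _ | yes w<n = w<n

    InvAt : ℕ → State → Set
    InvAt h σ = Inv h (regs σ tail) (arrays σ queue) (arrays σ lev) (arrays σ par)

    visit : Stmt
    visit = lev ⟦ reg Program.v ⟧≔ inc (lev ⟦ reg Program.u ⟧) ⍮
            par ⟦ reg Program.v ⟧≔ reg Program.u ⍮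
            enqueue Program.v

    fresh : Test
    fresh = adjacent? (reg Program.u) (reg Program.v) && neg (reg Program.v == reg removed)
              && lev ⟦ reg Program.v ⟧ == lit 0

    scan : Stmt
    scan = If fresh Then visit Else skip

    record Scanning (h c : ℕ) (σ : State) : Set where
      field
        inv      : InvAt h σ
        h<t      : h < regs σ tail
        u≡       : regs σ Program.u ≡ arrays σ queue h
        removed≡ : regs σ removed ≡ x
        scanned  : ∀ {w} → w < c → E (arrays σ queue h) w → Seen (arrays σ lev) (arrays σ queue h) w

    scan-correct : ∀ {h} c σ → c < n → Scanning h c σ → Scanning h (suc c) (run scan (setReg Program.v c σ))
    scan-correct {h} c σ c<n S =
        if-rule (Scanning h (suc c)) fresh visit skip {setReg Program.v c σ} visited skipped
      where
      open Scanning S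
      skipped : ⟦ fresh ⟧ᵗ (setReg Program.v c σ) ≡ false → Scanning h (suc c) (setReg Program.v c σ)
      skipped test = record
        { inv = inv ; h<t = h<t ; u≡ = u≡ ; removed≡ = removed≡
        ; scanned = λ w< Ew → [ (λ w<c → scanned w<c Ew) ,
            (λ { refl → seen inv h<t c<n (1≤l Ew test) }) ]′ (ℕₚ.m<1+n⇒m<n∨m≡n w<) }
        where
        1≤l : E (arrays σ queue h) c →
              (entry (regs σ Program.u) c ∧ not (c ≡ᵇ regs σ removed) ∧ (arrays σ lev c ≡ᵇ 0)) ≡ false →
              1 ≤ arrays σ lev c
        -- For a neighbour other than x only the last conjunct can have failed, so c is already
        -- labelled.
        1≤l (e , c≢x) test rewrite u≡ | removed≡ | e | ≢⇒≡ᵇ-false c≢x = ℕₚ.n≢0⇒n>0 (≡ᵇ-false test)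
      visited : ⟦ fresh ⟧ᵗ (setReg Program.v c σ) ≡ true →
          Scanning h (suc c) (run visit (setReg Program.v c σ))
      visited test = record
        { inv      = proj₁ pushed
        ; h<t      = ℕₚ.m<n⇒m<1+n h<t
        ; u≡       = trans u≡ (sym q-h)
        ; removed≡ = removed≡
        ; scanned  = λ {w} w< Ew → subst (λ u → Seen (arrays σ′ lev) u w) (sym q-h)
                       (scanned′ (ℕₚ.m<1+n⇒m<n∨m≡n w<) (subst (λ u → E u w) q-h Ew))
        }
        where
        σ′ = run visit (setReg Program.v c σ)
        t  = regs σ tail
        σ₀ = setReg Program.v c σ
        σ₁ = setCell lev c (suc (arrays σ lev (regs σ Program.u))) σ₀
        σ₂ = setCell par c (regs σ Program.u) σ₁
        tests = ∧-true {entry (regs σ Program.u) c} test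
        tests′ = ∧-true {not (c ≡ᵇ regs σ removed)} (proj₂ tests)
        E-c : E (arrays σ queue h) c
        E-c = subst (λ u → entry u c ≡ true) u≡ (proj₁ tests) ,
              λ c≡x → ≡ᵇ-false (not-true (proj₁ tests′)) (trans c≡x (sym removed≡))
        q-σ₂ : ∀ k → arrays σ₂ queue k ≡ arrays σ queue k
        q-σ₂ k = trans (setCell-array c _ σ₁ k (par≢queue ∘ sym)) (setCell-array c _ σ₀ k (lev≢queue ∘ sym))
        q-≢ : ∀ {k} → k ≢ t → arrays σ′ queue k ≡ arrays σ queue k
        q-≢ {k} k≢t = trans (setCell-index queue c σ₂ queue k≢t) (q-σ₂ k)
        q-h : arrays σ′ queue h ≡ arrays σ queue h
        q-h = q-≢ (ℕₚ.<⇒≢ h<t)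
        l-σ₁ : ∀ v → arrays σ′ lev v ≡ arrays σ₁ lev v
        l-σ₁ v = trans (setCell-array t c σ₂ v lev≢queue) (setCell-array c _ σ₁ v (par≢lev ∘ sym))
        p-σ₂ : ∀ v → arrays σ′ par v ≡ arrays σ₂ par v
        p-σ₂ v = setCell-array t c σ₂ v par≢queue
        pushed = push {q′ = arrays σ′ queue} {arrays σ′ lev} {arrays σ′ par} inv h<t c<n E-c
            (≡ᵇ-true (proj₂ tests′))
          (setCell-same queue t c σ₂) q-≢
          (trans (l-σ₁ c) (trans (setCell-same lev c _ σ₀) (cong (suc ∘ arrays σ lev) u≡)))
          (λ {v} v≢c → trans (l-σ₁ v) (setCell-index lev _ σ₀ lev v≢c))
          (trans (p-σ₂ c) (trans (setCell-same par c _ σ₁) u≡))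
          (λ {v} v≢c → trans (p-σ₂ v)
              (trans (setCell-index par _ σ₁ par v≢c) (setCell-array c _ σ₀ v par≢lev)))
        scanned′ : ∀ {w} → w < c ⊎ w ≡ c → E (arrays σ queue h) w → Seen (arrays σ′ lev) (arrays σ queue h) w
        scanned′ (inj₁ w<c)  Ew = proj₂ pushed (scanned w<c Ew)
        scanned′ (inj₂ refl) Ew = subst (λ u → Seen (arrays σ′ lev) u c) q-h
          (seen (proj₁ pushed) (ℕₚ.m<n⇒m<1+n h<t) c<n
              (subst (1 ≤_) (sym (trans (l-σ₁ c) (setCell-same lev c _ σ₀))) (s≤s z≤n)))

    expand : Stmt
    expand = If reg head << reg tail Then
        (Program.u ≔ queue ⟦ reg head ⟧ ⍮ For Program.v Below size Do scan) Else skip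

    Searching : ℕ → State → Set
    Searching h σ = InvAt h σ × regs σ removed ≡ x

    expand-correct : ∀ h σ → Searching h σ → Searching (suc h) (run expand (setReg head h σ))
    expand-correct h σ (inv , removed≡) =
        if-rule (Searching (suc h)) (reg head << reg tail)
        (Program.u ≔ queue ⟦ reg head ⟧ ⍮ For Program.v Below size Do scan) skip
      {setReg head h σ}
      (λ test → let S = iterate-invariant (Scanning h) (λ c τ → run scan (setReg Program.v c τ)) n
                          (record { inv = inv ; h<t = <ᵇ-true test ; u≡ = refl
                                  ; removed≡ = removed≡ ; scanned = λ () })
                          (λ c τ c<n → scan-correct c τ c<n)
                in process (Scanning.inv S) (λ _ Ew → Scanning.scanned S (entry-bound (proj₁ Ew)) Ew) ,
                    Scanning.removed≡ S)
      (λ test → process inv (λ h<t → contradiction h<t (ℕₚ.≤⇒≯ (<ᵇ-false test))) , removed≡)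

    search-correct : ∀ σ → regs σ removed ≡ x → regs σ a₁ ≡ s₁ → regs σ a₂ ≡ s₂ → s₁ < n → s₂ < n → s₁ ≢ s₂ →
                     Levels (arrays (run (search lev par) σ) lev) (arrays (run (search lev par) σ) par)
    search-correct σ removed≡ a₁≡ a₂≡ s₁<n s₂<n s₁≢s₂ =
      finish (proj₁ (iterate-invariant Searching (λ h τ → run expand (setReg head h τ)) n
        (subst₂ Started a≡ b≡ started s₁<n s₂<n s₁≢s₂ , trans (frame-reg clear σ refl) removed≡)
            (λ h τ _ → expand-correct h τ)))
      where
      clear : Stmt
      clear = For Program.v Below size Do lev ⟦ reg Program.v ⟧≔ lit 0
      σ₀ = run clear σ
      a = regs σ₀ a₁
      b = regs σ₀ a₂
      a≡ : a ≡ s₁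
      a≡ = trans (frame-reg clear σ refl) a₁≡
      b≡ : b ≡ s₂
      b≡ = trans (frame-reg clear σ refl) a₂≡
      cleared : ∀ {v} → v < n → arrays σ₀ lev v ≡ 0
      cleared = iterate-invariant (λ c τ → ∀ {v} → v < c → arrays τ lev v ≡ 0)
        (λ c τ → run (lev ⟦ reg Program.v ⟧≔ lit 0) (setReg Program.v c τ)) n {σ} (λ ())
        λ c τ _ zeros {w} w< → clearOne c τ zeros w (ℕₚ.m<1+n⇒m<n∨m≡n w<)
        where
        clearOne : ∀ c τ → (∀ {v} → v < c → arrays τ lev v ≡ 0) → ∀ w → w < c ⊎ w ≡ c →
                   arrays (setCell lev c 0 (setReg Program.v c τ)) lev w ≡ 0
        clearOne c τ zeros w (inj₁ w<c)  =
            trans (setCell-index lev 0 (setReg Program.v c τ) lev (ℕₚ.<⇒≢ w<c)) (zeros w<c)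
        clearOne c τ zeros w (inj₂ refl) = setCell-same lev c 0 (setReg Program.v c τ)
      σ₁ = setCell lev a 1 (setReg tail 0 σ₀)
      σ₂ = setReg tail 1 (setCell queue 0 a σ₁)
      σ₃ = setCell lev b 1 σ₂
      σ₄ = setReg tail 2 (setCell queue 1 b σ₃)
      l-σ₂ : ∀ v → arrays σ₂ lev v ≡ arrays σ₁ lev v
      l-σ₂ v = setCell-array 0 a σ₁ v lev≢queue
      l-σ₄ : ∀ v → arrays σ₄ lev v ≡ arrays σ₃ lev v
      l-σ₄ v = setCell-array 1 b σ₃ v lev≢queue
      -- The state mentions register contents rather than s₁ and s₂; the invariant is shown for
      -- these contents and transported.
      Started : ℕ → ℕ → Set
      Started s₁ s₂ = s₁ < n → s₂ < n → s₁ ≢ s₂ →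
        Bfs.Inv n E s₁ s₂ 0 2 (arrays σ₄ queue) (arrays σ₄ lev) (arrays σ₄ par)
      started : Started a b
      started a<n b<n a≢b = Bfs.start n E a b a<n b<n a≢b
        (trans (setCell-index queue {1} b σ₃ queue {0} λ ())
            (trans (setCell-array b 1 σ₂ 0 (lev≢queue ∘ sym)) (setCell-same queue 0 a σ₁)))
        (setCell-same queue 1 b σ₃)
        (trans (l-σ₄ a) (trans (setCell-index lev 1 σ₂ lev a≢b)
            (trans (l-σ₂ a) (setCell-same lev a 1 (setReg tail 0 σ₀)))))
        (trans (l-σ₄ b) (setCell-same lev b 1 σ₂))
        λ {v} v<n v≢a v≢b → trans (l-σ₄ v) (trans (setCell-index lev 1 σ₂ lev v≢b)
          (trans (l-σ₂ v) (trans (setCell-index lev 1 (setReg tail 0 σ₀) lev v≢a) (cleared v<n))))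

-- Correctness of the program

mapWalk : ∀ {n} {R S : Rel (Fin n) 0ℓ} → (∀ {u v} → R u v → S u v) → ∀ {k u v} → Walk R k u v → Walk S k u v
mapWalk f []      = []
mapWalk f (r ∷ p) = f r ∷ mapWalk f p

module ProgramCorrect {n : ℕ} (G : Graph n) where

  open Machine G
  open Rules G
  open Program hiding (i; y; u; v)

  entry-toℕ : ∀ u v → entry (toℕ u) (toℕ v) ≡ adj G u v
  entry-toℕ u v with toℕ u ℕₚ.<? n | toℕ v ℕₚ.<? n
  ... | yes u<n | yes v<n = cong₂ (adj G) (fromℕ<-toℕ u u<n) (fromℕ<-toℕ v v<n)
  ... | no ¬u<n | _       = contradiction (toℕ<n u) ¬u<n
  ... | yes _   | no ¬v<n = contradiction (toℕ<n v) ¬v<n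

  LevelsWithout : ℕ → (s₁ s₂ : Fin n) → (l p : ℕ → ℕ) → Set
  LevelsWithout x s₁ s₂ = Bfs.Levels n (λ v w → entry v w ≡ true × w ≢ x) (toℕ s₁) (toℕ s₂)

  Without : ℕ → Rel (Fin n) 0ℓ
  Without x u v = Adj G u v × toℕ v ≢ x

  module _ {x : ℕ} {s₁ s₂ : Fin n} {l p : ℕ → ℕ}
           (levels : LevelsWithout x s₁ s₂ l p) where

    private module L = Bfs.Levels levels

    predecessor : ∀ v {m} → l (toℕ v) ≡ suc (suc m) →
                  ∃ λ w → p (toℕ v) ≡ toℕ w × Without x w v × l (toℕ w) ≡ suc m
    predecessor v lv with L.parent (toℕ<n v) lv
    ... | p<n , (e , v≢x) , lp =
      w , sym w≡ , (trans (sym (entry-toℕ w v)) (subst (λ k → entry k (toℕ v) ≡ true) (sym w≡) e) , v≢x) ,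
      trans (cong l w≡) lp
      where
      w = fromℕ< p<n
      w≡ = toℕ-fromℕ< p<n

    -- Each predecessor is one level lower, so the walk back is exactly as long as the level allows.
    -- With `level-walk` for the opposite bound, levels measure distance.
    walkTo : ∀ {k} v → l (toℕ v) ≡ suc k → ∃ λ s → (s ≡ s₁ ⊎ s ≡ s₂) × Walk (Without x) k s v
    walkTo {zero}  v lv = v , [ inj₁ ∘ toℕ-injective , inj₂ ∘ toℕ-injective ]′ (L.level₁ (toℕ<n v) lv) , []
    walkTo {suc k} v lv =
      let w , _ , wv , lw = predecessor v lv
          s , s∈ , walk = walkTo w lw
      in s , s∈ , walk ∷ʳ wv

    level-walk : ∀ {k u v} → 1 ≤ l (toℕ u) → Walk (Without x) k u v →
                 1 ≤ l (toℕ v) × l (toℕ v) ≤ k + l (toℕ u)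
    level-walk 1≤ [] = 1≤ , ℕₚ.≤-refl
    level-walk {suc k} {u} 1≤ (_∷_ {v = w} (uw , w≢x) walk) =
      let 1≤w , lw≤ = L.step (toℕ<n u) 1≤ (trans (entry-toℕ u w) uw , w≢x)
          1≤v , lv≤ = level-walk 1≤w walk
      in 1≤v , ℕₚ.≤-trans lv≤ (ℕₚ.≤-trans (ℕₚ.+-monoʳ-≤ k lw≤) (ℕₚ.≤-reflexive (ℕₚ.+-suc k _)))

    level-source : ∀ {s} → s ≡ s₁ ⊎ s ≡ s₂ → l (toℕ s) ≡ 1
    level-source (inj₁ refl) = L.source₁
    level-source (inj₂ refl) = L.source₂

  module _ (e f : Edge G) {l p : ℕ → ℕ} {y : Fin n}
           (levels : LevelsWithout (toℕ y) (lo e) (hi e) l p)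
           (y∉e : ∀ {v} → v ∈ᵉ e → v ≢ y) where

    private
      ∉ : ∀ {v} → v ≢ y → v ∈ ∁ ⁅ y ⁆
      ∉ v≢y = x∉p⇒x∈∁p (v≢y ∘ x∈⁅y⁆⇒x≡y y)

    unreached⇒separates : l (toℕ (lo f)) ≡ 0 → (∀ {v} → v ∈ᵉ f → v ≢ y) → Separates G y e f
    unreached⇒separates l≡0 y∉f = (∉ (y∉e (inj₁ refl)) , ∉ (y∉e (inj₂ refl))) ,
        (∉ (y∉f (inj₁ refl)) , ∉ (y∉f (inj₂ refl))) ,
      λ s → contradiction (subst (1 ≤_) l≡0 (proj₁ (level-walk levels
               (ℕₚ.≤-reflexive (sym (level-source levels (inj₁ refl))))
               (mapWalk (λ { {_} {v} (_ , v∈ , uv) → uv , λ v≡y →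
                   x∈∁p⇒x∉p v∈ (subst (_∈ ⁅ y ⁆) (sym (toℕ-injective v≡y)) (x∈⁅x⁆ y)) })
                        (proj₂ (fromStar s)))))) λ ()

    reached⇒¬separates : l (toℕ (lo f)) ≢ 0 → ¬ Separates G y e f
    reached⇒¬separates l≢0 (_ , _ , ¬s) with l (toℕ (lo f)) in lf
    ... | zero  = l≢0 refl
    ... | suc k with walkTo levels (lo f) lf
    ...   | s , s∈ , walk = ¬s (fromSource s∈ ◅◅ within (s≢y s∈) walk)
      where
      s≢y : ∀ {s} → s ∈ᵉ e → s ≢ y
      s≢y = y∉e
      fromSource : ∀ {s} → s ∈ᵉ e → Star (AdjIn G (∁ ⁅ y ⁆)) (lo e) s
      fromSource (inj₁ refl) = ε
      fromSource (inj₂ refl) = (∉ (y∉e (inj₁ refl)) , ∉ (y∉e (inj₂ refl)) , Edge.adjacent e) ◅ ε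
      within : ∀ {k u v} → u ≢ y → Walk (Without (toℕ y)) k u v → Star (AdjIn G (∁ ⁅ y ⁆)) u v
      within u≢y []               = ε
      within u≢y ((uv , v≢y) ∷ w) = let v≢y′ = v≢y ∘ cong toℕ in (∉ u≢y , ∉ v≢y′ , uv) ◅ within v≢y′ w

  -- In the positive case `answer` is merely unchanged, since an earlier pair may already have set
  -- it to 0.
  Verdict : Set → State → State → Set
  Verdict Q σ τ = (regs τ answer ≡ regs σ answer × Q) ⊎ (regs τ answer ≡ 0 × ¬ Q)

  module _ (e f : Edge G) (a₁<b₁ : toℕ (lo e) < toℕ (lo f)) (b₁<a₂ : toℕ (lo f) < toℕ (hi e))
      (a₂<b₂ : toℕ (hi e) < toℕ (hi f)) where

    private
      cross : Crosses e f
      cross = inj₁ (a₁<b₁ , b₁<a₂ , a₂<b₂)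

      disjoint : ∀ {v} → v ∈ᵉ e → v ∈ᵉ f → ⊥
      disjoint = crosses-disjoint {e = e} {f} cross

      lo≢hi : toℕ (lo e) ≢ toℕ (hi e)
      lo≢hi = ℕₚ.<⇒≢ (Edge.lo<hi e)

    record Loaded (σ : State) : Set where
      field
        a₁≡ : regs σ a₁ ≡ toℕ (lo e)
        a₂≡ : regs σ a₂ ≡ toℕ (hi e)
        b₁≡ : regs σ b₁ ≡ toℕ (lo f)
        b₂≡ : regs σ b₂ ≡ toℕ (hi f)

    loaded-run : ∀ S {σ} → writesReg S a₁ ≡ false → writesReg S a₂ ≡ false →
                 writesReg S b₁ ≡ false → writesReg S b₂ ≡ false → Loaded σ → Loaded (run S σ)
    loaded-run S {σ} w₁ w₂ w₃ w₄ ld = record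
      { a₁≡ = trans (frame-reg S σ w₁) a₁≡ ; a₂≡ = trans (frame-reg S σ w₂) a₂≡
      ; b₁≡ = trans (frame-reg S σ w₃) b₁≡ ; b₂≡ = trans (frame-reg S σ w₄) b₂≡ }
      where open Loaded ld

    search₁ : ∀ σ → Loaded σ → regs σ removed ≡ n →
              LevelsWithout n (lo e) (hi e)
                (arrays (run (search level parent) σ) level) (arrays (run (search level parent) σ) parent)
    search₁ σ ld r≡ = SearchCorrect.search-correct G (λ ()) (λ ()) (λ ()) σ r≡
      (Loaded.a₁≡ ld) (Loaded.a₂≡ ld) (toℕ<n _) (toℕ<n _) lo≢hi

    search₂ : ∀ σ → Loaded σ → ∀ {x} → regs σ removed ≡ x →
              LevelsWithout x (lo e) (hi e)
                (arrays (run (search level′ parent′) σ) level′)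
                    (arrays (run (search level′ parent′) σ) parent′)
    search₂ σ ld r≡ = SearchCorrect.search-correct G (λ ()) (λ ()) (λ ()) σ r≡
      (Loaded.a₁≡ ld) (Loaded.a₂≡ ld) (toℕ<n _) (toℕ<n _) lo≢hi

    module _ {L Par : ℕ → ℕ}
             (levels : LevelsWithout n (lo e) (hi e) L Par) where

      private module Lv = Bfs.Levels levels

      in-G : ∀ {u v} → Adj G u v → Without n u v
      in-G {v = v} uv = uv , ℕₚ.<⇒≢ (toℕ<n v)

      level-e : ∀ {v} → v ∈ᵉ e → L (toℕ v) ≡ 1
      level-e = level-source levels

      unreached⇒¬least : L (toℕ (lo f)) ≡ 0 → ¬ ∃ (Least e f)
      unreached⇒¬least l≡0 (_ , ((_ , conn) , (l∈ , _) , (l′∈ , _)) , _) =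
        contradiction (subst (1 ≤_) l≡0 (proj₁ (level-walk levels (ℕₚ.≤-reflexive (sym (level-e (inj₁ refl))))
          (mapWalk (in-G ∘ AdjIn⊆Adj G) (proj₂ (fromStar (conn l∈ l′∈))))))) λ ()

      module _ {tgt : Fin n} (tgt∈ : tgt ∈ᵉ f) (nearer : ∀ {b} → b ∈ᵉ f → L (toℕ tgt) ≤ L (toℕ b))
               {d : ℕ} (level-tgt : L (toℕ tgt) ≡ suc d) where

        -- This is why the program compares the levels of both ends of f: the distance to the nearer
        -- one is the distance between the edges.
        far : Far e f d
        far {k} {a} {b} a∈ b∈ w = ℕ.s≤s⁻¹ (begin
          suc d          ≡⟨ level-tgt ⟨
          L (toℕ tgt)    ≤⟨ nearer b∈ ⟩
          L (toℕ b)      ≤⟨ proj₂ (level-walk levels (ℕₚ.≤-reflexive (sym (level-e a∈))) (mapWalk in-G w)) ⟩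
          k + L (toℕ a)  ≡⟨ cong (k +_) (level-e a∈) ⟩
          k + 1          ≡⟨ ℕₚ.+-comm k 1 ⟩
          suc k          ∎)
          where open ℕₚ.≤-Reasoning

        -- The part of the path from y on, all of whose vertices after y and before tgt
        -- have been found to separate e and f.
        record Chain (t : ℕ) (τ : State) : Set where
          constructor chain
          field
            {y z}    : Fin n
            {r j}    : ℕ
            y≡       : regs τ Program.y ≡ toℕ y
            level-y  : L (toℕ y) ≡ suc r
            yz       : Adj G y z
            z-tgt    : Star (SepAdj e f) z tgt
            walk     : Walk (Adj G) (suc j) y tgt
            total    : r + suc j ≡ d
            -- Either y has arrived at e, or each of the t rounds has moved it by one step.
            progress : r ≡ 0 ⊎ j ≡ t

        chain-separates : ∀ {y r j} → ∃ (Least e f) → L (toℕ y) ≡ suc (suc r) → Walk (Adj G) (suc j) y tgt →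
                          suc r + suc j ≡ d → Separates G y e f
        chain-separates {y} least ly walk total =
          let s , s∈ , w = walkTo levels y ly
          in least⇒separates e f least s∈ tgt∈ (s≤s z≤n) (s≤s z≤n) (mapWalk proj₁ w) walk
               (subst (Far e f) (sym total) far)

        -- The level of y is below that of `tgt`, the least level on f.
        chain-∉f : ∀ {y r j} → L (toℕ y) ≡ suc r → r + suc j ≡ d → ∀ {v} → v ∈ᵉ f → v ≢ y
        chain-∉f {y} {r} {j} ly total v∈ refl = ℕₚ.m+1+n≰m r (ℕₚ.≤-trans (ℕₚ.≤-reflexive total)
          (ℕ.s≤s⁻¹ (subst₂ _≤_ level-tgt ly (nearer v∈))))

        chain-finish : ∀ {τ} → Chain n τ → ∃ (Least e f)
        chain-finish (chain {y} {z} {r} {j} _ ly yz z-tgt _ total progress) =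
          separating⇒least e f ([ inj₁ ∘ toℕ-injective ,
              inj₂ ∘ toℕ-injective ]′ (Lv.level₁ (toℕ<n y) (trans ly (cong suc (r≡0 progress)))))
              yz z-tgt tgt∈
          where
          r≡0 : r ≡ 0 ⊎ j ≡ n → r ≡ 0
          r≡0 (inj₁ r≡0)  = r≡0
          -- Having moved in all n rounds, y would force the level of `tgt` above n.
          r≡0 (inj₂ refl) = contradiction
            (ℕₚ.≤-trans (s≤s (ℕₚ.≤-trans (ℕₚ.m≤n+m (suc n) r) (ℕₚ.≤-reflexive total)))
              (ℕₚ.≤-trans (ℕₚ.≤-reflexive (sym level-tgt)) (Lv.level≤n (toℕ<n tgt))))
            (ℕₚ.m+n≮n 1 n)

        module _ (σ : State) where

          -- The inner searches write to `level′` and `parent′`, so the predecessors from the search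
          -- in all of G survive to guide the path.
          record Kept (τ : State) : Set where
            field
              loaded : Loaded τ
              par≡   : ∀ v → arrays τ parent v ≡ Par v

          kept-run : ∀ S {τ} → writesReg S a₁ ≡ false → writesReg S a₂ ≡ false → writesReg S b₁ ≡ false →
                     writesReg S b₂ ≡ false → writesArray S parent ≡ false → Kept τ → Kept (run S τ)
          kept-run S {τ} w₁ w₂ w₃ w₄ w₅ kept = record
            { loaded = loaded-run S w₁ w₂ w₃ w₄ (Kept.loaded kept)
            ; par≡   = λ v → trans (frame-array S v τ w₅) (Kept.par≡ kept v) }

          PathInv : ℕ → State → Set
          PathInv t τ = Kept τ × ((regs τ answer ≡ regs σ answer × Chain t τ) ⊎
              (regs τ answer ≡ 0 × ¬ ∃ (Least e f)))

          inner : Test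
          inner = neg (reg Program.y == reg a₁) && neg (reg Program.y == reg a₂)

          record-answer advance body : Stmt
          record-answer = If level′ ⟦ reg b₁ ⟧ == lit 0 Then skip Else answer ≔ lit 0
          advance       = Program.y ≔ parent ⟦ reg Program.y ⟧
          body          = removed ≔ reg Program.y ⍮ search level′ parent′ ⍮ record-answer ⍮ advance

          round : ∀ t τ → PathInv t τ →
              PathInv (suc t) (run (If inner Then body Else skip) (setReg Program.i t τ))
          round t τ (kept , inj₂ (ans≡0 , ¬least)) =
            kept-run (Program.i ≔ lit t ⍮ S) refl refl refl refl refl kept ,
                inj₂ (zero-kept S (setReg Program.i t τ) refl ans≡0 , ¬least)
            where
            S = If inner Then body Else skip
          round t τ (kept , inj₁ (ans , chain {y} {z} {r} {j} y≡ ly yz z-tgt walk total progress)) =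
            if-rule (PathInv (suc t)) inner body skip {setReg Program.i t τ} passOn stay
            where
            open Loaded (Kept.loaded kept)
            τ₀ = setReg Program.i t τ
            kept₀ : Kept τ₀
            kept₀ = record { loaded = record { a₁≡ = a₁≡ ; a₂≡ = a₂≡ ; b₁≡ = b₁≡ ; b₂≡ = b₂≡ } ; par≡ =
                Kept.par≡ kept }
            stay : ⟦ inner ⟧ᵗ τ₀ ≡ false → PathInv (suc t) τ₀
            stay test = kept₀ , inj₁ (ans , chain y≡ ly yz z-tgt walk total
                (inj₁ (ℕₚ.suc-injective (trans (sym ly) (level-e (source test))))))
              where
              source : (not (regs τ Program.y ≡ᵇ regs τ a₁) ∧ not (regs τ Program.y ≡ᵇ regs τ a₂)) ≡ false →
                  y ∈ᵉ e
              source test with regs τ Program.y ≡ᵇ regs τ a₁ in eq₁ | regs τ Program.y ≡ᵇ regs τ a₂ in eq₂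
              ... | true  | _    = inj₁ (toℕ-injective (trans (sym y≡) (trans (≡ᵇ-true eq₁) a₁≡)))
              ... | false | true = inj₂ (toℕ-injective (trans (sym y≡) (trans (≡ᵇ-true eq₂) a₂≡)))
            passOn : ⟦ inner ⟧ᵗ τ₀ ≡ true → PathInv (suc t) (run body τ₀)
            passOn test = go ly total progress
              where
              y∉e : ∀ {v} → v ∈ᵉ e → v ≢ y
              y∉e (inj₁ refl) refl = ≡ᵇ-false
                  (not-true (proj₁ (∧-true {not (regs τ Program.y ≡ᵇ regs τ a₁)} test))) (trans y≡ (sym a₁≡))
              y∉e (inj₂ refl) refl = ≡ᵇ-false
                  (not-true (proj₂ (∧-true {not (regs τ Program.y ≡ᵇ regs τ a₁)} test))) (trans y≡ (sym a₂≡))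
              σ₁ = setReg removed (regs τ Program.y) τ₀
              σ₂ = run (search level′ parent′) σ₁
              kept₂ : Kept σ₂
              kept₂ = kept-run (removed ≔ reg Program.y ⍮ search level′ parent′) refl
                  refl refl refl refl kept₀
              levels₂ = search₂ σ₁ (loaded-run (removed ≔ reg Program.y) refl refl refl refl
                  (Kept.loaded kept₀)) y≡
              y₂≡ : regs σ₂ Program.y ≡ toℕ y
              y₂≡ = trans (frame-reg (search level′ parent′) σ₁ refl) y≡
              level-b₁ : arrays σ₂ level′ (regs σ₂ b₁) ≡ arrays σ₂ level′ (toℕ (lo f))
              level-b₁ = cong (arrays σ₂ level′) (Loaded.b₁≡ (Kept.loaded kept₂))
              go : ∀ {r} → L (toℕ y) ≡ suc r → r + suc j ≡ d → r ≡ 0 ⊎ j ≡ t → PathInv (suc t) (run body τ₀)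
              go {zero} ly _ _ = contradiction (Lv.level₁ (toℕ<n y) ly)
                [ y∉e (inj₁ refl) ∘ sym ∘ toℕ-injective , y∉e (inj₂ refl) ∘ sym ∘ toℕ-injective ]′
              go {suc m} ly total progress =
                let w , p≡ , (wy , _) , lw = predecessor levels y ly
                in if-rule (λ ρ → PathInv (suc t) (run advance ρ)) (level′ ⟦ reg b₁ ⟧ == lit 0) skip
                    (answer ≔ lit 0) {σ₂}
                  (λ l≡0 → kept-run advance refl refl refl refl refl kept₂ ,
                     inj₁ (trans (frame-reg (search level′ parent′) σ₁ refl) ans ,
                       chain (trans (cong (arrays σ₂ parent) y₂≡) (trans (Kept.par≡ kept₂ (toℕ y)) p≡)) lw wy
                         ((unreached⇒separates e f levels₂ y∉e (trans (sym level-b₁) (≡ᵇ-true l≡0))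
                             (chain-∉f ly total) , yz) ◅ z-tgt)
                         (wy ∷ walk) (trans (ℕₚ.+-suc m (suc j)) total)
                         ([ (λ ()) , inj₂ ∘ cong suc ]′ progress)))
                  (λ l≢0 → kept-run (answer ≔ lit 0 ⍮ advance) refl refl refl refl refl kept₂ ,
                     inj₂ (refl , λ least → reached⇒¬separates e f levels₂ y∉e (≡ᵇ-false l≢0 ∘ trans level-b₁)
                                              (chain-separates least ly walk total)))

          checkPath-correct : Kept σ → regs σ target ≡ toℕ tgt → Verdict (∃ (Least e f)) σ (run checkPath σ)
          checkPath-correct kept target≡ = [ (λ (ans , ch) → inj₁ (ans , chain-finish ch)) , inj₂ ]′
            (proj₂ (iterate-invariant PathInv
                (λ t τ → run (If inner Then body Else skip) (setReg Program.i t τ)) n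
              (start d level-tgt) (λ t τ _ → round t τ)))
            where
            start : ∀ d′ → L (toℕ tgt) ≡ suc d′ → PathInv 0 (run (Program.y ≔ parent ⟦ reg target ⟧) σ)
            start zero lt = contradiction (Lv.level₁ (toℕ<n tgt) lt)
              [ (λ eq → disjoint (inj₁ (toℕ-injective eq)) tgt∈) ,
                  (λ eq → disjoint (inj₂ (toℕ-injective eq)) tgt∈) ]′
            start (suc m) lt =
              let w , p≡ , (wt , _) , lw = predecessor levels tgt lt
              in kept-run (Program.y ≔ parent ⟦ reg target ⟧) refl refl refl refl refl kept ,
                 inj₁ (refl , chain (trans (cong (arrays σ parent) target≡)
                     (trans (Kept.par≡ kept (toℕ tgt)) p≡)) lw wt ε
                                (wt ∷ []) (trans (ℕₚ.+-comm m 1)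
                                    (ℕₚ.suc-injective (trans (sym lt) level-tgt))) (inj₂ refl))

    checkPair-correct : ∀ σ → Loaded σ → Verdict (∃ (Least e f)) σ (run checkPair σ)
    checkPair-correct σ ld =
      if-rule (Verdict (∃ (Least e f)) σ) (level ⟦ reg b₁ ⟧ == lit 0) (answer ≔ lit 0) choose {σ₂}
        (λ l≡0 → inj₂ (refl , unreached⇒¬least levels (trans (sym level-b₁) (≡ᵇ-true l≡0))))
        (λ l≢0 → if-rule (λ ρ → Verdict (∃ (Least e f)) σ (run checkPath ρ))
           (level ⟦ reg b₂ ⟧ << level ⟦ reg b₁ ⟧) (target ≔ reg b₂) (target ≔ reg b₁) {σ₂}
           (λ lt → let lt′ = subst₂ _<_ level-b₂ level-b₁ (<ᵇ-true lt) in
             verdict (target ≔ reg b₂) refl refl refl refl refl refl (inj₂ refl) b₂≡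
               [ (λ { refl → ℕₚ.<⇒≤ lt′ }) , (λ { refl → ℕₚ.≤-refl }) ]′ (≡ᵇ-false l≢0))
           (λ ge → let ge′ = subst₂ _≤_ level-b₁ level-b₂ (<ᵇ-false ge) in
             verdict (target ≔ reg b₁) refl refl refl refl refl refl (inj₁ refl) b₁≡
               [ (λ { refl → ℕₚ.≤-refl }) , (λ { refl → ge′ }) ]′ (≡ᵇ-false l≢0)))
      where
      σ₁ = setReg removed n σ
      σ₂ = run (search level parent) σ₁
      choose : Stmt
      choose = (If level ⟦ reg b₂ ⟧ << level ⟦ reg b₁ ⟧ Then target ≔ reg b₂ Else target ≔ reg b₁) ⍮ checkPath
      levels = search₁ σ₁ (loaded-run (removed ≔ size) refl refl refl refl ld) refl
      loaded₂ : Loaded σ₂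
      loaded₂ = loaded-run (removed ≔ size ⍮ search level parent) refl refl refl refl ld
      open Loaded loaded₂
      L = arrays σ₂ level
      level-b₁ : L (regs σ₂ b₁) ≡ L (toℕ (lo f))
      level-b₁ = cong L b₁≡
      level-b₂ : L (regs σ₂ b₂) ≡ L (toℕ (hi f))
      level-b₂ = cong L b₂≡
      -- Nothing is removed in this search, so f itself leads from one endpoint to the other, and
      -- testing `b₁` alone suffices.
      reached : L (toℕ (lo f)) ≢ 0 → ∀ {b} → b ∈ᵉ f → 1 ≤ L (toℕ b)
      reached l≢0 (inj₁ refl) = ℕₚ.n≢0⇒n>0 l≢0
      reached l≢0 (inj₂ refl) = proj₁
          (level-walk levels (ℕₚ.n≢0⇒n>0 l≢0) (in-G levels (Edge.adjacent f) ∷ []))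
      verdict : ∀ S → writesReg S a₁ ≡ false → writesReg S a₂ ≡ false → writesReg S b₁ ≡ false →
                writesReg S b₂ ≡ false → writesArray S parent ≡ false → writesReg S answer ≡ false →
                ∀ {tgt} → tgt ∈ᵉ f → regs (run S σ₂) target ≡ toℕ tgt →
                    (∀ {b} → b ∈ᵉ f → L (toℕ tgt) ≤ L (toℕ b)) →
                L (regs σ₂ b₁) ≢ 0 → Verdict (∃ (Least e f)) σ (run checkPath (run S σ₂))
      verdict S w₁ w₂ w₃ w₄ w₅ w₆ {tgt} tgt∈ target≡ nearer l≢0 =
        [ (λ (ans , least) → inj₁ (trans ans
            (trans (frame-reg S σ₂ w₆) (frame-reg (search level parent) σ₁ refl)) , least)) , inj₂ ]′
          (checkPath-correct levels tgt∈ nearer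
              (sym (ℕₚ.suc-pred (L (toℕ tgt)) {{ℕ.>-nonZero (reached (l≢0 ∘ trans level-b₁) tgt∈)}}))
            (run S σ₂)
            (record { loaded = loaded-run S w₁ w₂ w₃ w₄ loaded₂ ; par≡ = λ v → frame-array S v σ₂ w₅ })
                target≡)

  -- The loops over all pairs of crossing edges

  Bad : Set
  Bad = ∃₂ λ (e f : Edge G) → Crosses e f × ¬ ∃ (Least e f)

  Status : Set → State → Set
  Status Q σ = (regs σ answer ≡ 1 × Q) ⊎ (regs σ answer ≡ 0 × Bad)

  -- Running S adds R to whatever Q holds so far, unless a bad pair is known. Quantifying over Q
  -- lets nested loops accumulate their results.
  Covers : (State → Set) → Stmt → Set → Set₁
  Covers Fr S R = ∀ σ {Q} → Fr σ → Status Q σ → Status (Q × R) (run S σ)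

  for-covers : ∀ r S (Fr : State → Set) {R : ℕ → Set} → (answer ≡ᵇ r) ≡ false →
               (∀ {σ} j → Fr σ → Fr (setReg r j σ)) → (∀ {σ} → Fr σ → Fr (run S σ)) →
               (∀ j → Covers (λ σ → Fr σ × regs σ r ≡ j) S (R j)) →
               Covers Fr (For r Below size Do S) (∀ j → j < n → R j)
  for-covers r S Fr {R} ans≢r fr-set fr-run covers σ {Q} fr st =
    proj₂ (iterate-invariant (λ k τ → Fr τ × Status (Q × (∀ j → j < k → R j)) τ)
        (λ j τ → run S (setReg r j τ)) n {σ}
      (fr , [ (λ (a , q) → inj₁ (a , q , λ _ ())) , inj₂ ]′ st) next)
    where
    keep : ∀ {Q} j τ → Status Q τ → Status Q (setReg r j τ)
    keep j τ = [ (λ (a , q) → inj₁ (trans (cong (λ b → if b then j else regs τ answer) ans≢r) a , q)) ,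
                 (λ (a , b) → inj₂ (trans (cong (λ b → if b then j else regs τ answer) ans≢r) a , b)) ]′
    next : ∀ k τ → k < n → Fr τ × Status (Q × (∀ j → j < k → R j)) τ →
            Fr (run S (setReg r k τ)) × Status (Q × (∀ j → j < suc k → R j)) (run S (setReg r k τ))
    next k τ _ (fr , st) = fr-run (fr-set k fr) ,
      [ (λ (a , (q , before) , now) → inj₁ (a , q , λ j j<1+k → [ before j ,
          (λ { refl → now }) ]′ (ℕₚ.m<1+n⇒m<n∨m≡n j<1+k))) , inj₂ ]′
        (covers k (setReg r k τ) (fr-set k fr ,
            trans (cong (λ b → if b then k else regs τ r) (≡ᵇ-refl r)) refl) (keep k τ st))

  -- Phrased for numbers, as the loop counters are numbers; it holds vacuously for quadruples that
  -- are not crossing edges.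
  PairClosed : (a b c d : ℕ) → Set
  PairClosed a b c d = ∀ (e f : Edge G) → toℕ (lo e) ≡ a → toℕ (lo f) ≡ b → toℕ (hi e) ≡ c → toℕ (hi f) ≡ d →
                       a < b → b < c → c < d → ∃ (Least e f)

  -- Edges with the same endpoints may carry different proofs, but `Least` sees only the endpoints.
  least-cong : ∀ {e f e′ f′ : Edge G} → toℕ (lo e) ≡ toℕ (lo e′) → toℕ (hi e) ≡ toℕ (hi e′) →
               toℕ (lo f) ≡ toℕ (lo f′) → toℕ (hi f) ≡ toℕ (hi f′) → ∃ (Least e f) → ∃ (Least e′ f′)
  least-cong {record { lo = l₁ ; hi = h₁ }} {record { lo = l₂ ; hi = h₂ }} {record {}} {record {}} p q r s
    with refl ← toℕ-injective p | refl ← toℕ-injective q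
       | refl ← toℕ-injective r | refl ← toℕ-injective s = id

  entry-edge : ∀ {a b} → a < b → entry a b ≡ true → ∃ λ (e : Edge G) → toℕ (lo e) ≡ a × toℕ (hi e) ≡ b
  entry-edge {a} {b} a<b ab with a ℕₚ.<? n | b ℕₚ.<? n
  ... | yes a<n | yes b<n = record { lo = fromℕ< a<n ; hi = fromℕ< b<n
                                   ; lo<hi = subst₂ _<_ (sym (toℕ-fromℕ< a<n))
                                       (sym (toℕ-fromℕ< b<n)) a<b ; adjacent = ab } ,
                            toℕ-fromℕ< a<n , toℕ-fromℕ< b<n

  crossing : Test
  crossing = reg a₁ << reg b₁ && reg b₁ << reg a₂ && reg a₂ << reg b₂
               && adjacent? (reg a₁) (reg a₂) && adjacent? (reg b₁) (reg b₂)

  crossing⁻ : ∀ σ → ⟦ crossing ⟧ᵗ σ ≡ true →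
              regs σ a₁ < regs σ b₁ × regs σ b₁ < regs σ a₂ × regs σ a₂ < regs σ b₂ ×
              entry (regs σ a₁) (regs σ a₂) ≡ true × entry (regs σ b₁) (regs σ b₂) ≡ true
  crossing⁻ σ test =
    let t₁ , test = ∧-true {regs σ a₁ <ᵇ regs σ b₁} test
        t₂ , test = ∧-true {regs σ b₁ <ᵇ regs σ a₂} test
        t₃ , test = ∧-true {regs σ a₂ <ᵇ regs σ b₂} test
        t₄ , t₅   = ∧-true {entry (regs σ a₁) (regs σ a₂)} test
    in <ᵇ-true t₁ , <ᵇ-true t₂ , <ᵇ-true t₃ , t₄ , t₅

  crossing⁺ : ∀ σ → regs σ a₁ < regs σ b₁ → regs σ b₁ < regs σ a₂ → regs σ a₂ < regs σ b₂ →
              entry (regs σ a₁) (regs σ a₂) ≡ true → entry (regs σ b₁) (regs σ b₂) ≡ true →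
              ⟦ crossing ⟧ᵗ σ ≡ true
  crossing⁺ σ a<b b<c c<d ac bd rewrite <⇒<ᵇ-true a<b | <⇒<ᵇ-true b<c | <⇒<ᵇ-true c<d | ac = bd

  pair-covers : ∀ {a b c d} →
      Covers (λ σ → (((⊤ × regs σ a₁ ≡ a) × regs σ b₁ ≡ b) × regs σ a₂ ≡ c) × regs σ b₂ ≡ d)
                  (If crossing Then checkPair Else skip) (PairClosed a b c d)
  pair-covers σ {Q} ((((_ , refl) , refl) , refl) , refl) st =
    if-rule (Status (Q × PairClosed (regs σ a₁) (regs σ b₁) (regs σ a₂) (regs σ b₂)))
        crossing checkPair skip {σ} check
      λ test → [ (λ (a , q) → inj₁ (a , q , λ e f p₁ p₂ p₃ p₄ a<b b<c c<d → contradiction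
                   (trans (sym test) (crossing⁺ σ a<b b<c c<d (adjacent e p₁ p₃) (adjacent f p₂ p₄)))
                       λ ())) , inj₂ ]′ st
    where
    adjacent : ∀ e {u v} → toℕ (lo e) ≡ u → toℕ (hi e) ≡ v → entry u v ≡ true
    adjacent e refl refl = trans (entry-toℕ (lo e) (hi e)) (Edge.adjacent e)
    check : ⟦ crossing ⟧ᵗ σ ≡ true →
        Status (Q × PairClosed (regs σ a₁) (regs σ b₁) (regs σ a₂) (regs σ b₂)) (run checkPair σ)
    check test with crossing⁻ σ test
    ... | a<b , b<c , c<d , ac , bd
      with entry-edge (ℕₚ.<-trans a<b b<c) ac | entry-edge (ℕₚ.<-trans b<c c<d) bd
    ... | e , le , he | f , lf , hf = conclude
        (checkPair-correct e f a<b′ b<c′ c<d′ σ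
          record { a₁≡ = sym le ; a₂≡ = sym he ; b₁≡ = sym lf ; b₂≡ = sym hf }) st
      where
      a<b′ = subst₂ _<_ (sym le) (sym lf) a<b
      b<c′ = subst₂ _<_ (sym lf) (sym he) b<c
      c<d′ = subst₂ _<_ (sym he) (sym hf) c<d
      conclude : Verdict (∃ (Least e f)) σ (run checkPair σ) → Status Q σ →
                 Status (Q × PairClosed (regs σ a₁) (regs σ b₁) (regs σ a₂) (regs σ b₂)) (run checkPair σ)
      conclude (inj₂ (ans≡0 , ¬least)) _ = inj₂ (ans≡0 , e , f , inj₁ (a<b′ , b<c′ , c<d′) , ¬least)
      conclude (inj₁ (ans≡ , least)) = [ (λ (a , q) → inj₁ (trans ans≡ a , q , λ e′ f′ p₁ p₂ p₃ p₄ _ _ _ →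
          least-cong {e} {f} {e′} {f′} (trans le (sym p₁)) (trans he (sym p₃))
              (trans lf (sym p₂)) (trans hf (sym p₄)) least)) ,
        (λ (a , bad) → inj₂ (trans ans≡ a , bad)) ]′

  loop₄ loop₃ loop₂ loop₁ : Stmt
  loop₄ = For b₂ Below size Do If crossing Then checkPair Else skip
  loop₃ = For a₂ Below size Do loop₄
  loop₂ = For b₁ Below size Do loop₃
  loop₁ = For a₁ Below size Do loop₂

  AllPairsClosed : Set
  AllPairsClosed = ∀ a → a < n → ∀ b → b < n → ∀ c → c < n → ∀ d → d < n → PairClosed a b c d

  program-correct : Status AllPairsClosed (run program initial)
  program-correct = [ (λ (a , q) → inj₁ (a , proj₂ q)) ,
      inj₂ ]′ (covers₁ (setReg answer 1 initial) tt (inj₁ (refl , tt)))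
    where
    covers₄ : ∀ {a b c} → Covers (λ σ → ((⊤ × regs σ a₁ ≡ a) × regs σ b₁ ≡ b) × regs σ a₂ ≡ c) loop₄
        (∀ d → d < n → PairClosed a b c d)
    covers₄ = for-covers b₂ (If crossing Then checkPair Else skip)
        (λ σ → ((⊤ × regs σ a₁ ≡ _) × regs σ b₁ ≡ _) × regs σ a₂ ≡ _) refl (λ _ → id)
      (λ {σ} (((_ , p) , q) , r) → ((_ , trans (frame-reg (If crossing Then checkPair Else skip) σ refl) p) ,
                                     trans (frame-reg (If crossing Then checkPair Else skip) σ refl) q) ,
                                     trans (frame-reg (If crossing Then checkPair Else skip) σ refl) r)
      λ _ → pair-covers
    covers₃ : ∀ {a b} → Covers (λ σ → (⊤ × regs σ a₁ ≡ a) × regs σ b₁ ≡ b) loop₃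
        (∀ c → c < n → ∀ d → d < n → PairClosed a b c d)
    covers₃ = for-covers a₂ loop₄ (λ σ → (⊤ × regs σ a₁ ≡ _) × regs σ b₁ ≡ _) refl (λ _ → id)
      (λ {σ} ((_ , p) , q) → (_ , trans (frame-reg loop₄ σ refl) p) , trans (frame-reg loop₄ σ refl) q)
      λ _ → covers₄
    covers₂ : ∀ {a} → Covers (λ σ → ⊤ × regs σ a₁ ≡ a) loop₂ (∀ b → b < n → ∀ c →
        c < n → ∀ d → d < n → PairClosed a b c d)
    covers₂ = for-covers b₁ loop₃ (λ σ → ⊤ × regs σ a₁ ≡ _) refl (λ _ → id)
        (λ {σ} (_ , p) → _ , trans (frame-reg loop₃ σ refl) p) λ _ → covers₃
    covers₁ : Covers (λ _ → ⊤) loop₁ (∀ a → a < n → ∀ b → b < n → ∀ c → c < n → ∀ d →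
        d < n → PairClosed a b c d)
    covers₁ = for-covers a₁ loop₂ (λ _ → ⊤) refl (λ _ → id) (λ _ → _) λ _ → covers₂

  -- The paths of `someRun` may differ from those found by the program; the two are compared pair by
  -- pair through the existence of a least set.
  programAnswer-correct : Outputs G (someRun G) (programAnswer G)
  programAnswer-correct = output _ program-correct
    where
    output : ∀ x → (x ≡ 1 × AllPairsClosed) ⊎ (x ≡ 0 × Bad) →
        Outputs G (someRun G) (if x ≡ᵇ 0 then No else Yes)
    output _ (inj₂ (refl , e , f , cross , ¬least)) = ¬least⇒no G (someRun G) e f cross ¬least
    output _ (inj₁ (refl , closed)) (e , f , cross , fails) =
      fails⇒¬least cross (someRun G e f cross) fails (close e f cross)
      where
      close : ∀ (e f : Edge G) → Crosses e f → ∃ (Least e f)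
      close e f (inj₁ (p , q , r)) =
        closed _ (toℕ<n _) _ (toℕ<n _) _ (toℕ<n _) _ (toℕ<n _) e f refl refl refl refl p q r
      -- The program meets this pair in the opposite order.
      close e f (inj₂ (p , q , r)) =
        let M , least = closed _ (toℕ<n _) _ (toℕ<n _) _ (toℕ<n _) _ (toℕ<n _) f e refl refl refl refl p q r
        in M , least-swap {e = f} {e} least

theoremA2 : (∀ (n : ℕ) (G : Graph n) →
    (∀ (e f : Edge G) → Crosses e f → (P : PathBetween e f) → 3 ≤ length P)
    × (∀ (r : Run G) → Outputs G r Yes ⇔ CrossingClosed G)
    × (CrossingClosed G ⇔ IsLatticePoset (NC G))
    × (Σ (Run G) λ r → Outputs G r (programAnswer G)))
    × (∃₂ λ (C n₀ : ℕ) → ∀ (n : ℕ) → n₀ ≤ n → (G : Graph n) →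
    programTime G ≤ C * n ^ 7)
theoremA2 =
  (λ n G → (λ e f → length≥3 {e = e} {f}) , outputsYes⇔crossingClosed G ,
           mk⇔ (crossingClosed⇒lattice G) (lattice⇒crossingClosed G) ,
           someRun G , ProgramCorrect.programAnswer-correct G) ,
  -- 222 is the weight of the program, and its loops nest to depth 7.
  222 , 1 , λ { (suc n) _ G → Rules.time-bound G Program.program initial refl }
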